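{- Let $n=p_1^{\alpha_1}\cdots p_k^{\alpha_k}$, where $k\geq 1$, $\alpha_i\geq 1$ and the $p_i$ are distinct primes satisfying $p_i\equiv 1\pmod 4$ for all $i=1,\ldots,k$. Then the number $\mathcal{K}_3(G_n)$ of cliques of order three in the Paley-type graph $G_n$ is $$\mathcal{K}_3(G_n)=\frac{1}{3\times 2^{3k+1}}\prod_{i=1}^{k}\left[p_i^{3\alpha_i-2}(p_i-1)(p_i-5)\right].$$
   Context: For $n=p_1^{\alpha_1}\cdots p_k^{\alpha_k}$ with distinct primes $p_i\equiv 1\pmod 4$ and $\alpha_i\ge 1$, let $\mathbb{Z}_n^\ast$ be the group of units of the ring $\mathbb{Z}_n=\mathbb{Z}/n\mathbb{Z}$. The Paley-type graph $G_n$ is the simple undirected graph with vertex set $\mathbb{Z}_n$ in which $xy$ is an edge if and only if $x-y\equiv a^2\pmod n$ for some $a\in\mathbb{Z}_n^\ast$ (this is symmetric since $-1$ is a square in $\mathbb{Z}_n^\ast$). For a graph $G$, $\mathcal{K}_m(G)$ denotes the number of cliques of order $m$ in $G$, i.e. the number of $m$-element sets of pairwise adjacent vertices. -}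

module Defs where

open import Data.Fin.Base using (Fin; toℕ)
open import Data.Fin.Properties using (all?; any?) renaming (_≟_ to _≟ᶠ_)
open import Data.Fin.Subset using (Subset; inside; outside; _∈_; ∣_∣)
open import Data.Fin.Subset.Properties using (_∈?_)
open import Data.Integer.Base as ℤ using (ℤ; +_)
open import Data.Integer.Divisibility.Signed using (_∣_; _∣?_)
open import Data.List.Base using (List; []; _∷_; _++_; map; filter; length)
open import Data.Nat.Base as ℕ using (ℕ; zero; suc; NonZero)
import Data.Nat.Properties as ℕ
open import Data.Product.Base using (Σ-syntax; _×_)
open import Data.Vec.Base using ([]; _∷_)
open import Data.Vec.Functional using (Vector; foldr)
open import Level using (0ℓ)
open import Relation.Binary.Core using (Rel)
open import Relation.Binary.Definitions using (Decidable)
open import Relation.Binary.PropositionalEquality.Core using (_≡_; _≢_)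
open import Relation.Nullary.Decidable using (Dec; ¬?; _×-dec_; _→-dec_)

∏ : ∀ {k} → Vector ℕ k → ℕ
∏ = foldr ℕ._*_ 1

∏ℤ : ∀ {k} → Vector ℤ k → ℤ
∏ℤ = foldr ℤ._*_ (+ 1)

3*2^m≢0 : ∀ m → NonZero (3 ℕ.* 2 ℕ.^ m)
3*2^m≢0 m = ℕ.m*n≢0 3 (2 ℕ.^ m) {{_}} {{ℕ.m^n≢0 2 m}}

-- ℤₙ is represented by Fin n, each residue class by its representative in
-- {0, …, n - 1}; ring identities in ℤₙ are congruences modulo n between integers.

infix 4 _≡_[mod_] _≡_[mod_]?

_≡_[mod_] : ℤ → ℤ → ℕ → Set
x ≡ y [mod n ] = + n ∣ x ℤ.- y

_≡_[mod_]? : ∀ x y n → Dec (x ≡ y [mod n ])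
x ≡ y [mod n ]? = + n ∣? x ℤ.- y

⟦_⟧ : ∀ {n} → Fin n → ℤ
⟦ x ⟧ = + toℕ x

IsUnit : ∀ {n} → Fin n → Set
IsUnit {n} a = Σ[ b ∈ Fin n ] ⟦ a ⟧ ℤ.* ⟦ b ⟧ ≡ + 1 [mod n ]

isUnit? : ∀ {n} (a : Fin n) → Dec (IsUnit a)
isUnit? {n} a = any? λ b → ⟦ a ⟧ ℤ.* ⟦ b ⟧ ≡ + 1 [mod n ]?

-- The adjacency relation of the Paley-type graph on ℤₙ.  It is symmetric
-- because -1 is the square of a unit for the n considered, and irreflexive
-- because 0 is not a unit for n > 1.
G : ∀ n → Rel (Fin n) 0ℓ
G n x y = Σ[ a ∈ Fin n ] IsUnit a × ⟦ x ⟧ ℤ.- ⟦ y ⟧ ≡ ⟦ a ⟧ ℤ.* ⟦ a ⟧ [mod n ]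

G? : ∀ n → Decidable (G n)
G? n x y = any? λ a → isUnit? a ×-dec ⟦ x ⟧ ℤ.- ⟦ y ⟧ ≡ ⟦ a ⟧ ℤ.* ⟦ a ⟧ [mod n ]?

IsClique : ∀ {n} → Rel (Fin n) 0ℓ → Subset n → Set
IsClique E s = ∀ x y → x ∈ s → y ∈ s → x ≢ y → E x y

isClique? : ∀ {n} {E : Rel (Fin n) 0ℓ} → Decidable E → ∀ s → Dec (IsClique E s)
isClique? E? s = all? λ x → all? λ y →
  (x ∈? s) →-dec (y ∈? s) →-dec ¬? (x ≟ᶠ y) →-dec E? x y

-- Every subset of Fin n exactly once.
subsets : ∀ n → List (Subset n)
subsets zero    = [] ∷ []
subsets (suc n) = map (outside ∷_) (subsets n) ++ map (inside ∷_) (subsets n)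

𝒦 : ∀ m {n} {E : Rel (Fin n) 0ℓ} → Decidable E → ℕ
𝒦 m {n} E? = length (filter (λ s → (∣ s ∣ ℕ.≟ m) ×-dec isClique? E? s) (subsets n))

{-# OPTIONS --safe #-}

-- Six times the number of triangles counts ordered triples of pairwise adjacent
-- vertices, which after translation are pairs (u , v) with u, v and u + v unit
-- squares, weighted by n.  Counting square roots instead of squares costs a factor
-- #√1 for each of the three conditions and turns the pairs into unit solutions of
-- a² + b² = c².  Dividing by b and writing a + c = t reduces these to the units t
-- for which t⁴ - 1 is a unit too.  All the resulting counts are multiplicative in n
-- by the Chinese remainder theorem, and modulo a prime p ≡ 1 (mod 4) the
-- polynomial t (t⁴ - 1) has exactly five roots.  That -1 is a square modulo pᵃ
-- follows by parity: there are φ(pᵃ)/2 unit squares, an even number, so inversion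
-- cannot have 1 as its only fixed point among them.
module Submission where

open import Defs
open import Data.Bool.Base using (if_then_else_; true; false)
open import Data.Fin.Base using (Fin; zero; suc; toℕ; fromℕ<; punchIn)
open import Data.Fin.Permutation using (permutation)
open import Data.Fin.Properties using (any?; toℕ<n; toℕ-injective; toℕ-fromℕ<; punchInᵢ≢i; suc-injective; _<?_; <-cmp; all?) renaming (_≟_ to _≟ᶠ_)
open import Data.Fin.Subset using (Subset; inside; outside; _∈_) renaming (∣_∣ to ∣_∣ˢ)
open import Data.Fin.Subset.Properties using (_∈?_)
open import Data.Integer.Base as ℤ using (ℤ; +_; ∣_∣; 1ℤ; 0ℤ; -1ℤ) renaming (_+_ to _+ᶻ_; _*_ to _*ᶻ_; _-_ to _-ᶻ_; -_ to -ᶻ_)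
open import Data.Integer.DivMod using (_%ℕ_; _/ℕ_; n%ℕd<d; a≡a%ℕn+[a/ℕn]*n)
open import Data.Integer.Divisibility.Signed using (divides; _∣_; ∣⇒∣ᵤ; ∣m∣n⇒∣m+n; ∣n⇒∣m*n; ∣-trans)
import Data.Integer.Properties as ℤ
open import Data.Integer.Tactic.RingSolver using (solve-∀)
open import Data.List.Base using ([]; _∷_; _++_; map; filter; length)
open import Data.List.Properties using (filter-++; filter-≐; length-++; filter-none)
import Data.List.Relation.Unary.All as All
open import Data.Nat.Base as ℕ using (ℕ; zero; suc; NonZero; _≤_; _<_; _+_; _*_; _^_; _∸_; _%_)
open import Data.Nat.Coprimality using (Coprime; coprime-Bézout; coprime-divisor; 1-coprimeTo; prime⇒coprime) renaming (sym to coprime-sym)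
open import Data.Nat.DivMod using (m≡m%n+[m/n]*n)
open import Data.Nat.Divisibility as ℕ∣ using (>⇒∤)
open import Data.Nat.GCD using (module Bézout)
open import Data.Nat.Primality using (Prime; prime⇒nonZero; prime⇒irreducible; prime⇒nonTrivial)
import Data.Nat.Properties as ℕ
open import Data.Nat.Tactic.RingSolver using () renaming (solve-∀ to ℕ-solve-∀)
open import Data.Product.Base using (∃; _×_; _,_; proj₁; proj₂)
open import Data.Rational.Base as ℚ using (_/_)
import Data.Rational.Properties as ℚ
open import Data.Rational.Unnormalised.Base as ℚᵘ using (mkℚᵘ; *≡*)
import Data.Rational.Unnormalised.Properties as ℚᵘ
open import Data.Sum.Base using (_⊎_; inj₁; inj₂; [_,_]′)
open import Data.Unit.Base using (tt)
open import Data.Vec.Base using ([]; _∷_; here; there)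
open import Function.Base using (_∘_; id)
open import Function.Definitions using (Injective)
open import Level using (0ℓ)
open import Relation.Binary.Core using (Rel)
open import Relation.Binary.Definitions using (tri<; tri≈; tri>; Decidable; Symmetric)
open import Relation.Binary.PropositionalEquality.Core using (_≡_; _≢_; refl; sym; trans; cong; cong₂; subst)
open import Relation.Binary.PropositionalEquality.Properties using (module ≡-Reasoning)
open import Relation.Nullary.Decidable using (Dec; yes; no; does; map′; _×-dec_; decidable-stable; _→-dec_)
open import Relation.Nullary.Negation using (¬_; contradiction)
open import Algebra.Properties.Semiring.Sum ℕ.+-*-semiring using (sum; sum-syntax; sum-cong-≗; sum-replicate-zero; sum-remove; ∑-distrib-+; ∑-comm; ∑-permute; *-distribˡ-sum; *-distribʳ-sum)

-- Functions on ℤ/n are encoded as functions on all of ℤ that are periodic modulo `n`. One integer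
-- argument then makes sense for every modulus at once, so the Chinese remainder theorem becomes an
-- identity between sums of products, and congruences reduce to polynomial identities over ℤ. Square
-- roots are counted because a sum over squares does not lend itself to substitution, whereas a sum
-- over the roots can be translated, scaled and interchanged. A square root `i` of -1 serves twice:
-- it makes adjacency symmetric, and it supplies the roots `i` and `-i` of t⁴ - 1 modulo `p`. The
-- parity argument covers prime powers only. For composite `n` the existence of `i` is carried over
-- as the nonvanishing of the number of solutions of x² = -1, which is a product over the prime
-- powers. The local counts are stated additively, as `φ p + 1 ≡ p` and `∑mod p (α p) + 5 ≡ p`, and
-- become p - 1 and p - 5 only once they are cast to integers.

infix 4 _≈_[_] _≈?_[_]

-- A record, unlike the definition it wraps, lets Agda infer x and y.
record _≈_[_] (x y : ℤ) (n : ℕ) : Set where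
  constructor ≈-by
  field congruent : x ≡ y [mod n ]

open _≈_[_] public

opaque

  _≈?_[_] : ∀ x y n → Dec (x ≈ y [ n ])
  x ≈? y [ n ] = map′ ≈-by congruent (x ≡ y [mod n ]?)

module _ {n : ℕ} where

  -- The difference of the two sides is an explicit multiple of a difference already known to
  -- vanish. Supplying the multiplier `c` leaves a polynomial identity over ℤ, which the ring solver
  -- settles; `≈-lin₂` does the same with two known congruences.
  ≈-lin : ∀ {x y a b} c → a ≈ b [ n ] → x -ᶻ y ≡ c *ᶻ (a -ᶻ b) → x ≈ y [ n ]
  ≈-lin c (≈-by p) eq = ≈-by (subst (+ n ∣_) (sym eq) (∣n⇒∣m*n c p))

  ≈-lin₂ : ∀ {x y a b a′ b′} c c′ → a ≈ b [ n ] → a′ ≈ b′ [ n ] →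
           x -ᶻ y ≡ c *ᶻ (a -ᶻ b) +ᶻ c′ *ᶻ (a′ -ᶻ b′) → x ≈ y [ n ]
  ≈-lin₂ c c′ (≈-by p) (≈-by p′) eq =
    ≈-by (subst (+ n ∣_) (sym eq) (∣m∣n⇒∣m+n (∣n⇒∣m*n c p) (∣n⇒∣m*n c′ p′)))

  ≈-reflexive : ∀ {x y} → x ≡ y → x ≈ y [ n ]
  ≈-reflexive {x} refl = ≈-by (divides 0ℤ (ℤ.+-inverseʳ x))

  ≈-refl : ∀ {x} → x ≈ x [ n ]
  ≈-refl = ≈-reflexive refl

  ≈-sym : ∀ {x y} → x ≈ y [ n ] → y ≈ x [ n ]
  ≈-sym {x} {y} p = ≈-lin -1ℤ p (eq x y)
    where
    eq : ∀ x y → y -ᶻ x ≡ -1ℤ *ᶻ (x -ᶻ y)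
    eq = solve-∀

  ≈-trans : ∀ {x y z} → x ≈ y [ n ] → y ≈ z [ n ] → x ≈ z [ n ]
  ≈-trans {x} {y} {z} p q = ≈-lin₂ 1ℤ 1ℤ p q (eq x y z)
    where
    eq : ∀ x y z → x -ᶻ z ≡ 1ℤ *ᶻ (x -ᶻ y) +ᶻ 1ℤ *ᶻ (y -ᶻ z)
    eq = solve-∀

  +-cong : ∀ {x y z w} → x ≈ y [ n ] → z ≈ w [ n ] → x +ᶻ z ≈ y +ᶻ w [ n ]
  +-cong {x} {y} {z} {w} p q = ≈-lin₂ 1ℤ 1ℤ p q (eq x y z w)
    where
    eq : ∀ x y z w → (x +ᶻ z) -ᶻ (y +ᶻ w) ≡ 1ℤ *ᶻ (x -ᶻ y) +ᶻ 1ℤ *ᶻ (z -ᶻ w)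
    eq = solve-∀

  *-cong : ∀ {x y z w} → x ≈ y [ n ] → z ≈ w [ n ] → x *ᶻ z ≈ y *ᶻ w [ n ]
  *-cong {x} {y} {z} {w} p q = ≈-lin₂ z y p q (eq x y z w)
    where
    eq : ∀ x y z w → x *ᶻ z -ᶻ y *ᶻ w ≡ z *ᶻ (x -ᶻ y) +ᶻ y *ᶻ (z -ᶻ w)
    eq = solve-∀

  neg-cong : ∀ {x y} → x ≈ y [ n ] → -ᶻ x ≈ -ᶻ y [ n ]
  neg-cong {x} {y} p = ≈-lin -1ℤ p (eq x y)
    where
    eq : ∀ x y → -ᶻ x -ᶻ -ᶻ y ≡ -1ℤ *ᶻ (x -ᶻ y)
    eq = solve-∀

  +-congˡ : ∀ x {y z} → y ≈ z [ n ] → x +ᶻ y ≈ x +ᶻ z [ n ]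
  +-congˡ x = +-cong (≈-refl {x})

  +-congʳ : ∀ z {x y} → x ≈ y [ n ] → x +ᶻ z ≈ y +ᶻ z [ n ]
  +-congʳ z p = +-cong p (≈-refl {z})

  *-congˡ : ∀ x {y z} → y ≈ z [ n ] → x *ᶻ y ≈ x *ᶻ z [ n ]
  *-congˡ x = *-cong (≈-refl {x})

  *-congʳ : ∀ z {x y} → x ≈ y [ n ] → x *ᶻ z ≈ y *ᶻ z [ n ]
  *-congʳ z p = *-cong p (≈-refl {z})

  ≈-divisor : ∀ {m x y} → + m ∣ + n → x ≈ y [ n ] → x ≈ y [ m ]
  ≈-divisor d (≈-by p) = ≈-by (∣-trans d p)

-- Representatives of residue classes

⟦⟧-injective : ∀ {n} {i j : Fin n} → ⟦ i ⟧ ≈ ⟦ j ⟧ [ n ] → i ≡ j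
⟦⟧-injective {n} {i} {j} (≈-by p) = toℕ-injective (ℤ.+-injective (ℤ.i-j≡0⇒i≡j ⟦ i ⟧ ⟦ j ⟧ diff≡0))
  where
  -- Both representatives lie between 0 and n - 1, so their difference is too small to be a nonzero
  -- multiple of `n`.
  ∣diff∣<n : ∣ ⟦ i ⟧ -ᶻ ⟦ j ⟧ ∣ < n
  ∣diff∣<n = ℕ.≤-<-trans
    (ℕ.≤-trans (ℕ.≤-reflexive (cong ∣_∣ (ℤ.m-n≡m⊖n (toℕ i) (toℕ j)))) (ℤ.∣m⊝n∣≤m⊔n (toℕ i) (toℕ j)))
    (ℕ.⊔-lub (toℕ<n i) (toℕ<n j))

  diff≡0 : ⟦ i ⟧ -ᶻ ⟦ j ⟧ ≡ 0ℤ
  diff≡0 with ∣ ⟦ i ⟧ -ᶻ ⟦ j ⟧ ∣ in eq | ∣⇒∣ᵤ p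
  ... | zero  | _   = ℤ.∣i∣≡0⇒i≡0 eq
  ... | suc d | n∣d = contradiction n∣d (>⇒∤ (subst (_< n) eq ∣diff∣<n))

residue : ∀ n .{{_ : NonZero n}} → ℤ → Fin n
residue n x = fromℕ< (n%ℕd<d x n)

residue-≈ : ∀ n .{{_ : NonZero n}} x → ⟦ residue n x ⟧ ≈ x [ n ]
residue-≈ n x = ≈-by (divides (-ᶻ (x /ℕ n)) (begin
  ⟦ residue n x ⟧ -ᶻ x             ≡⟨ cong (λ r → + r -ᶻ x) (toℕ-fromℕ< (n%ℕd<d x n)) ⟩
  + (x %ℕ n) -ᶻ x                  ≡⟨ cong (λ y → r -ᶻ y) (a≡a%ℕn+[a/ℕn]*n x n) ⟩
  r -ᶻ (r +ᶻ x /ℕ n *ᶻ + n)        ≡⟨ eq r (x /ℕ n) (+ n) ⟩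
  -ᶻ (x /ℕ n) *ᶻ + n               ∎))
  where
  open ≡-Reasoning
  r = + (x %ℕ n)
  eq : ∀ r q n → r -ᶻ (r +ᶻ q *ᶻ n) ≡ -ᶻ q *ᶻ n
  eq = solve-∀

Respects : ∀ {ℓ} → ℕ → (ℤ → Set ℓ) → Set ℓ
Respects n P = ∀ {x y} → x ≈ y [ n ] → P x → P y

-- The search over all integers is finite because a predicate that respects congruence is determined
-- by its values on the representatives.
∃? : ∀ {n ℓ} .{{_ : NonZero n}} {P : ℤ → Set ℓ} → Respects n P → (∀ x → Dec (P x)) → Dec (∃ P)
∃? {n} resp P? = map′ (λ (i , p) → ⟦ i ⟧ , p) (λ (x , p) → residue n x , resp (≈-sym (residue-≈ n x)) p)
  (any? (λ i → P? ⟦ i ⟧))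

-- Indicator functions of decidable propositions

opaque

  𝟙 : ∀ {ℓ} {P : Set ℓ} → Dec P → ℕ
  𝟙 p = if does p then 1 else 0

opaque
  unfolding 𝟙

  𝟙-yes : ∀ {ℓ} {P : Set ℓ} (d : Dec P) → P → 𝟙 d ≡ 1
  𝟙-yes (yes _) p = refl
  𝟙-yes (no ¬p) p = contradiction p ¬p

  𝟙-no : ∀ {ℓ} {P : Set ℓ} (d : Dec P) → ¬ P → 𝟙 d ≡ 0
  𝟙-no (yes p) ¬p = contradiction p ¬p
  𝟙-no (no _)  ¬p = refl

  𝟙-*-cong : ∀ {ℓ} {P : Set ℓ} (d : Dec P) → ∀ {x y} → (P → x ≡ y) → 𝟙 d * x ≡ 𝟙 d * y
  𝟙-*-cong (yes p) eq = cong (1 *_) (eq p)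
  𝟙-*-cong (no _)  eq = refl

  𝟙-cases : ∀ {ℓ} {P : Set ℓ} (d : Dec P) → ∀ {x y} → (P → x ≡ y) → (¬ P → x ≡ 0) → x ≡ 𝟙 d * y
  𝟙-cases (yes p) {y = y} if-P if-¬P = trans (if-P p) (sym (ℕ.*-identityˡ y))
  𝟙-cases (no ¬p) if-P if-¬P         = if-¬P ¬p

  𝟙-⊎ : ∀ {ℓ ℓ₁ ℓ₂} {R : Set ℓ} {P : Set ℓ₁} {Q : Set ℓ₂} (c : Dec R) (d : Dec P) (e : Dec Q) → ¬ (P × Q) →
         (R → P ⊎ Q) → (P ⊎ Q → R) → 𝟙 c ≡ 𝟙 d + 𝟙 e
  𝟙-⊎ c (yes p) (yes q) ¬pq to from = contradiction (p , q) ¬pq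
  𝟙-⊎ c (yes p) (no ¬q) ¬pq to from = 𝟙-yes c (from (inj₁ p))
  𝟙-⊎ c (no ¬p) (yes q) ¬pq to from = 𝟙-yes c (from (inj₂ q))
  𝟙-⊎ c (no ¬p) (no ¬q) ¬pq to from = 𝟙-no c (λ r → [ ¬p , ¬q ]′ (to r))

  𝟙-× : ∀ {ℓ ℓ′} {P : Set ℓ} {Q : Set ℓ′} (d : Dec P) (e : Dec Q) → 𝟙 (d ×-dec e) ≡ 𝟙 d * 𝟙 e
  𝟙-× (yes p) (yes q) = refl
  𝟙-× (yes p) (no ¬q) = refl
  𝟙-× (no ¬p) e       = refl

𝟙-cong : ∀ {ℓ ℓ′} {P : Set ℓ} {Q : Set ℓ′} (d : Dec P) (e : Dec Q) → (P → Q) → (Q → P) → 𝟙 d ≡ 𝟙 e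
𝟙-cong d@(yes p) e to from = trans (𝟙-yes d p) (sym (𝟙-yes e (to p)))
𝟙-cong d@(no ¬p) e to from = trans (𝟙-no d ¬p) (sym (𝟙-no e (¬p ∘ from)))

-- Sums over ℤ/n

opaque

  ∑mod : ℕ → (ℤ → ℕ) → ℕ
  ∑mod n f = ∑[ i < n ] f ⟦ i ⟧

Periodic : ℕ → (ℤ → ℕ) → Set
Periodic n f = ∀ {x y} → x ≈ y [ n ] → f x ≡ f y

𝟙-periodic : ∀ {n ℓ} {P : ℤ → Set ℓ} (P? : ∀ x → Dec (P x)) → Respects n P → Periodic n (𝟙 ∘ P?)
𝟙-periodic P? resp {x} {y} p = 𝟙-cong (P? x) (P? y) (resp p) (resp (≈-sym p))

*-periodic : ∀ {n f g} → Periodic n f → Periodic n g → Periodic n (λ x → f x * g x)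
*-periodic pf pg p = cong₂ _*_ (pf p) (pg p)

sum-const : ∀ n c → ∑[ i < n ] c ≡ n * c
sum-const zero    c = refl
sum-const (suc n) c = cong (c ℕ.+_) (sum-const n c)

sum-𝟙-≟ : ∀ {n} (f : Fin n → ℕ) j → ∑[ i < n ] (𝟙 (i ≟ᶠ j) * f i) ≡ f j
sum-𝟙-≟ {suc n} f j = begin
  ∑[ i < suc n ] g i                      ≡⟨ sum-remove {i = j} g ⟩
  g j + ∑[ i < n ] g (punchIn j i)        ≡⟨ cong₂ _+_ (cong (_* f j) (𝟙-yes (j ≟ᶠ j) refl)) (sum-cong-≗ off-diagonal) ⟩
  1 * f j + ∑[ i < n ] 0                  ≡⟨ cong₂ _+_ (ℕ.*-identityˡ (f j)) (sum-replicate-zero n) ⟩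
  f j + 0                                 ≡⟨ ℕ.+-identityʳ (f j) ⟩
  f j                                     ∎
  where
  open ≡-Reasoning
  g = λ i → 𝟙 (i ≟ᶠ j) * f i
  off-diagonal : ∀ i → g (punchIn j i) ≡ 0
  off-diagonal i = cong (_* f (punchIn j i)) (𝟙-no (punchIn j i ≟ᶠ j) (punchInᵢ≢i j i))

module _ (n : ℕ) where

  opaque
    unfolding ∑mod

    ∑mod-cong : ∀ {f g : ℤ → ℕ} → (∀ x → f x ≡ g x) → ∑mod n f ≡ ∑mod n g
    ∑mod-cong eq = sum-cong-≗ {n} (λ i → eq ⟦ i ⟧)

    ∑mod-const : ∀ c → ∑mod n (λ _ → c) ≡ n * c
    ∑mod-const = sum-const n

    ∑mod-+ : ∀ f g → ∑mod n (λ x → f x + g x) ≡ ∑mod n f + ∑mod n g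
    ∑mod-+ f g = ∑-distrib-+ {n} (λ i → f ⟦ i ⟧) (λ i → g ⟦ i ⟧)

    ∑mod-*ˡ : ∀ c f → ∑mod n (λ x → c * f x) ≡ c * ∑mod n f
    ∑mod-*ˡ c f = sym (*-distribˡ-sum {n} c (λ i → f ⟦ i ⟧))

    ∑mod-*ʳ : ∀ c f → ∑mod n (λ x → f x * c) ≡ ∑mod n f * c
    ∑mod-*ʳ c f = sym (*-distribʳ-sum {n} c (λ i → f ⟦ i ⟧))

    ∑mod-comm : ∀ m (f : ℤ → ℤ → ℕ) → ∑mod n (λ x → ∑mod m (f x)) ≡ ∑mod m (λ y → ∑mod n (λ x → f x y))
    ∑mod-comm m f = ∑-comm {n} {m} (λ i j → f ⟦ i ⟧ ⟦ j ⟧)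

module _ (n : ℕ) .{{_ : NonZero n}} where

  opaque
    unfolding ∑mod

    -- `g` and `h` are inverse only up to congruence; after reduction to representatives they become
    -- a genuine permutation of `Fin n`.
    ∑mod-reindex : ∀ {f : ℤ → ℕ} (g h : ℤ → ℤ) → Periodic n f →
      (∀ {x y} → x ≈ y [ n ] → g x ≈ g y [ n ]) → (∀ {x y} → x ≈ y [ n ] → h x ≈ h y [ n ]) →
      (∀ x → g (h x) ≈ x [ n ]) → (∀ x → h (g x) ≈ x [ n ]) →
      ∑mod n (f ∘ g) ≡ ∑mod n f
    ∑mod-reindex {f} g h pf g-cong h-cong gh hg = begin
      ∑[ i < n ] f (g ⟦ i ⟧)                ≡⟨ sum-cong-≗ {n} (λ i → pf (≈-sym (residue-≈ n (g ⟦ i ⟧)))) ⟩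
      ∑[ i < n ] f ⟦ lift g i ⟧             ≡⟨ ∑-permute (λ i → f ⟦ i ⟧) (permutation (lift g) (lift h) (inverse g-cong gh) (inverse h-cong hg)) ⟨
      ∑[ i < n ] f ⟦ i ⟧                    ∎
      where
      open ≡-Reasoning
      lift : (ℤ → ℤ) → Fin n → Fin n
      lift k i = residue n (k ⟦ i ⟧)
      inverse : ∀ {k l : ℤ → ℤ} → (∀ {x y} → x ≈ y [ n ] → k x ≈ k y [ n ]) →
                (∀ x → k (l x) ≈ x [ n ]) → ∀ i → lift k (lift l i) ≡ i
      inverse {k} {l} k-cong kl i = ⟦⟧-injective
        (≈-trans (residue-≈ n _) (≈-trans (k-cong (residue-≈ n _)) (kl ⟦ i ⟧)))

    ∑mod-𝟙-≈ : ∀ {f : ℤ → ℕ} c → Periodic n f → ∑mod n (λ x → 𝟙 (x ≈? c [ n ]) * f x) ≡ f c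
    ∑mod-𝟙-≈ {f} c pf = begin
      ∑[ i < n ] (𝟙 (⟦ i ⟧ ≈? c [ n ]) * f ⟦ i ⟧)    ≡⟨ sum-cong-≗ {n} (λ i → cong (_* f ⟦ i ⟧) (same i)) ⟩
      ∑[ i < n ] (𝟙 (i ≟ᶠ residue n c) * f ⟦ i ⟧)    ≡⟨ sum-𝟙-≟ (λ i → f ⟦ i ⟧) (residue n c) ⟩
      f ⟦ residue n c ⟧                              ≡⟨ pf (residue-≈ n c) ⟩
      f c                                            ∎
      where
      open ≡-Reasoning
      same : ∀ i → 𝟙 (⟦ i ⟧ ≈? c [ n ]) ≡ 𝟙 (i ≟ᶠ residue n c)
      same i = 𝟙-cong (⟦ i ⟧ ≈? c [ n ]) (i ≟ᶠ residue n c)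
        (λ p → ⟦⟧-injective (≈-trans p (≈-sym (residue-≈ n c)))) (λ { refl → residue-≈ n c })

  ∑mod-𝟙 : ∀ c → ∑mod n (λ x → 𝟙 (x ≈? c [ n ])) ≡ 1
  ∑mod-𝟙 c = trans (∑mod-cong n (λ x → sym (ℕ.*-identityʳ (𝟙 (x ≈? c [ n ]))))) (∑mod-𝟙-≈ {λ _ → 1} c (λ _ → refl))

  ∑mod-translate : ∀ {f : ℤ → ℕ} c → Periodic n f → ∑mod n (λ x → f (x +ᶻ c)) ≡ ∑mod n f
  ∑mod-translate c pf = ∑mod-reindex (_+ᶻ c) (_-ᶻ c) pf (+-congʳ c) (+-congʳ (-ᶻ c))
    (λ x → ≈-reflexive (eq₁ x c)) (λ x → ≈-reflexive (eq₂ x c))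
    where
    eq₁ : ∀ x c → (x -ᶻ c) +ᶻ c ≡ x
    eq₁ = solve-∀
    eq₂ : ∀ x c → (x +ᶻ c) -ᶻ c ≡ x
    eq₂ = solve-∀

  ∑mod-scale : ∀ {f : ℤ → ℕ} b b⁻¹ → b *ᶻ b⁻¹ ≈ 1ℤ [ n ] → Periodic n f → ∑mod n (λ x → f (b *ᶻ x)) ≡ ∑mod n f
  ∑mod-scale b b⁻¹ inv pf = ∑mod-reindex (b *ᶻ_) (b⁻¹ *ᶻ_) pf (*-congˡ b) (*-congˡ b⁻¹)
    (λ x → ≈-lin x inv (eq₁ x b b⁻¹)) (λ x → ≈-lin x inv (eq₂ x b b⁻¹))
    where
    eq₁ : ∀ x b c → b *ᶻ (c *ᶻ x) -ᶻ x ≡ x *ᶻ (b *ᶻ c -ᶻ 1ℤ)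
    eq₁ = solve-∀
    eq₂ : ∀ x b c → c *ᶻ (b *ᶻ x) -ᶻ x ≡ x *ᶻ (b *ᶻ c -ᶻ 1ℤ)
    eq₂ = solve-∀

opaque
  unfolding ∑mod

  ∑mod-split-+ : ∀ m n f → ∑mod (m + n) f ≡ ∑mod m f + ∑mod n (λ x → f (+ m +ᶻ x))
  ∑mod-split-+ zero    n f = ∑mod-cong n (λ x → cong f (sym (ℤ.+-identityˡ x)))
  ∑mod-split-+ (suc m) n f = begin
    f 0ℤ + ∑mod (m + n) f⁺                                     ≡⟨ cong (f 0ℤ ℕ.+_) (∑mod-split-+ m n f⁺) ⟩
    f 0ℤ + (∑mod m f⁺ + ∑mod n (λ x → f (1ℤ +ᶻ (+ m +ᶻ x))))   ≡⟨ ℕ.+-assoc (f 0ℤ) _ _ ⟨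
    ∑mod (suc m) f + ∑mod n (λ x → f (1ℤ +ᶻ (+ m +ᶻ x)))       ≡⟨ cong (∑mod (suc m) f ℕ.+_) (∑mod-cong n (λ x → cong f (ℤ.+-assoc 1ℤ (+ m) x))) ⟨
    ∑mod (suc m) f + ∑mod n (λ x → f (+ suc m +ᶻ x))           ∎
    where
    open ≡-Reasoning
    f⁺ : ℤ → ℕ
    f⁺ x = f (1ℤ +ᶻ x)

  -- Division with remainder: every representative modulo `n * m` is i + m j for exactly one i below
  -- `m` and one j below `n`.
  ∑mod-split-* : ∀ m n f → ∑mod (n * m) f ≡ ∑mod n (λ j → ∑mod m (λ i → f (i +ᶻ + m *ᶻ j)))
  ∑mod-split-* m zero    f = refl
  ∑mod-split-* m (suc n) f = begin
    ∑mod (m + n * m) f                                                    ≡⟨ ∑mod-split-+ m (n * m) f ⟩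
    ∑mod m f + ∑mod (n * m) (λ x → f (+ m +ᶻ x))                          ≡⟨ cong₂ _+_ (∑mod-cong m (λ x → cong f (eq₀ x (+ m)))) (∑mod-split-* m n (λ x → f (+ m +ᶻ x))) ⟩
    ∑mod m (λ i → f (i +ᶻ + m *ᶻ 0ℤ)) + ∑mod n (λ j → ∑mod m (λ i → f (+ m +ᶻ (i +ᶻ + m *ᶻ j))))
      ≡⟨ cong (∑mod m (λ i → f (i +ᶻ + m *ᶻ 0ℤ)) ℕ.+_) (∑mod-cong n (λ j → ∑mod-cong m (λ i → cong f (eq₁ i j (+ m))))) ⟩
    ∑mod (suc n) (λ j → ∑mod m (λ i → f (i +ᶻ + m *ᶻ j)))                 ∎
    where
    open ≡-Reasoning
    eq₀ : ∀ x m → x ≡ x +ᶻ m *ᶻ 0ℤ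
    eq₀ = solve-∀
    eq₁ : ∀ i j m → m +ᶻ (i +ᶻ m *ᶻ j) ≡ i +ᶻ m *ᶻ (1ℤ +ᶻ j)
    eq₁ = solve-∀

opaque
  unfolding ∑mod

  ∑mod≡∑ : ∀ {n} f → ∑mod n f ≡ ∑[ i < n ] f ⟦ i ⟧
  ∑mod≡∑ f = refl

  ∑mod-1 : ∀ f → ∑mod 1 f ≡ f 0ℤ
  ∑mod-1 f = ℕ.+-identityʳ (f 0ℤ)

  -- This recovers a witness from a nonzero count. A square root of -1 modulo a composite number is
  -- obtained in this way.
  ∑mod-≢0 : ∀ {ℓ} n {P : ℤ → Set ℓ} (P? : ∀ x → Dec (P x)) → ∑mod n (𝟙 ∘ P?) ≢ 0 → ∃ P
  ∑mod-≢0 n P? ≢0 with any? {n} (λ i → P? ⟦ i ⟧)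
  ... | yes (i , p) = ⟦ i ⟧ , p
  ... | no ¬∃       = contradiction
    (trans (sum-cong-≗ {n} (λ i → 𝟙-no (P? ⟦ i ⟧) (λ p → ¬∃ (i , p)))) (sum-replicate-zero n)) ≢0

sum≡0 : ∀ {n} (f : Fin n → ℕ) → sum f ≡ 0 → ∀ i → f i ≡ 0
sum≡0 f eq zero    = ℕ.m+n≡0⇒m≡0 (f zero) eq
sum≡0 f eq (suc i) = sum≡0 (f ∘ suc) (ℕ.m+n≡0⇒n≡0 (f zero) eq) i

∑mod-𝟙-≢0 : ∀ n .{{_ : NonZero n}} {ℓ} {P : ℤ → Set ℓ} (P? : ∀ x → Dec (P x)) → Respects n P →
            ∀ {x} → P x → ∑mod n (𝟙 ∘ P?) ≢ 0
∑mod-𝟙-≢0 n P? resp {x} p ∑≡0 = contradiction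
  (trans (sym (𝟙-yes (P? ⟦ i ⟧) (resp (≈-sym (residue-≈ n x)) p))) (sum≡0 (λ i → 𝟙 (P? ⟦ i ⟧)) (trans (sym (∑mod≡∑ (𝟙 ∘ P?))) ∑≡0) i))
  λ ()
  where i = residue n x

-- Coprime moduli

coprime⇒inverse : ∀ {m n} → Coprime m n → ∃ λ u → + m *ᶻ u ≈ 1ℤ [ n ]
coprime⇒inverse {m} {n} c with coprime-Bézout c
... | Bézout.+- x y eq = + x , ≈-by (divides (+ y) (begin
  + m *ᶻ + x -ᶻ 1ℤ               ≡⟨ cong (_-ᶻ 1ℤ) (ℤ.pos-* m x) ⟨
  + (m * x) -ᶻ 1ℤ                ≡⟨ cong (λ k → + k -ᶻ 1ℤ) (trans (ℕ.*-comm m x) (sym eq)) ⟩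
  + (1 + y * n) -ᶻ 1ℤ            ≡⟨ cong (_-ᶻ 1ℤ) (ℤ.pos-+ 1 (y * n)) ⟩
  1ℤ +ᶻ + (y * n) -ᶻ 1ℤ          ≡⟨ cong (λ k → 1ℤ +ᶻ k -ᶻ 1ℤ) (ℤ.pos-* y n) ⟩
  1ℤ +ᶻ + y *ᶻ + n -ᶻ 1ℤ         ≡⟨ eq₁ (+ y *ᶻ + n) ⟩
  + y *ᶻ + n                     ∎))
  where
  open ≡-Reasoning
  eq₁ : ∀ z → 1ℤ +ᶻ z -ᶻ 1ℤ ≡ z
  eq₁ = solve-∀
-- Here the Bézout identity over ℕ reads 1 + x m = y n, so the inverse of `m` is -x.
... | Bézout.-+ x y eq = -ᶻ + x , ≈-by (divides (-ᶻ + y) (begin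
  + m *ᶻ -ᶻ + x -ᶻ 1ℤ            ≡⟨ eq₁ (+ m) (+ x) ⟩
  -ᶻ (1ℤ +ᶻ + x *ᶻ + m)          ≡⟨ cong (λ k → -ᶻ (1ℤ +ᶻ k)) (ℤ.pos-* x m) ⟨
  -ᶻ + (1 + x * m)               ≡⟨ cong (λ k → -ᶻ + k) eq ⟩
  -ᶻ + (y * n)                   ≡⟨ cong -ᶻ_ (ℤ.pos-* y n) ⟩
  -ᶻ (+ y *ᶻ + n)                ≡⟨ ℤ.neg-distribˡ-* (+ y) (+ n) ⟩
  -ᶻ + y *ᶻ + n                  ∎))
  where
  open ≡-Reasoning
  eq₁ : ∀ m x → m *ᶻ -ᶻ x -ᶻ 1ℤ ≡ -ᶻ (1ℤ +ᶻ x *ᶻ m)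
  eq₁ = solve-∀

m≈0 : ∀ m → + m ≈ 0ℤ [ m ]
m≈0 m = ≈-by (divides 1ℤ (eq (+ m)))
  where
  eq : ∀ x → x -ᶻ 0ℤ ≡ 1ℤ *ᶻ x
  eq = solve-∀

+-multiple : ∀ m i j → i +ᶻ + m *ᶻ j ≈ i [ m ]
+-multiple m i j = ≈-lin j (m≈0 m) (eq i (+ m) j)
  where
  eq : ∀ i m j → (i +ᶻ m *ᶻ j) -ᶻ i ≡ j *ᶻ (m -ᶻ 0ℤ)
  eq = solve-∀

∑mod-multiple : ∀ m n {f} → Periodic m f → ∑mod (n * m) f ≡ n * ∑mod m f
∑mod-multiple m n {f} pf = begin
  ∑mod (n * m) f                                     ≡⟨ ∑mod-split-* m n f ⟩
  ∑mod n (λ j → ∑mod m (λ i → f (i +ᶻ + m *ᶻ j)))    ≡⟨ ∑mod-cong n (λ j → ∑mod-cong m (λ i → pf (+-multiple m i j))) ⟩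
  ∑mod n (λ _ → ∑mod m f)                            ≡⟨ ∑mod-const n _ ⟩
  n * ∑mod m f                                       ∎
  where open ≡-Reasoning

-- The Chinese remainder theorem, in the form of a Fubini identity.
∑mod-coprime : ∀ {m n} .{{_ : NonZero n}} → Coprime m n → ∀ {f g} → Periodic m f → Periodic n g →
  ∑mod (n * m) (λ x → f x * g x) ≡ ∑mod m f * ∑mod n g
∑mod-coprime {m} {n} c {f} {g} pf pg = begin
  ∑mod (n * m) (λ x → f x * g x)
    ≡⟨ ∑mod-split-* m n _ ⟩
  ∑mod n (λ j → ∑mod m (λ i → f (i +ᶻ + m *ᶻ j) * g (i +ᶻ + m *ᶻ j)))
    ≡⟨ ∑mod-comm n m _ ⟩
  ∑mod m (λ i → ∑mod n (λ j → f (i +ᶻ + m *ᶻ j) * g (i +ᶻ + m *ᶻ j)))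
    ≡⟨ ∑mod-cong m (λ i → ∑mod-cong n (λ j → cong (_* g (i +ᶻ + m *ᶻ j)) (pf (+-multiple m i j)))) ⟩
  ∑mod m (λ i → ∑mod n (λ j → f i * g (i +ᶻ + m *ᶻ j)))
    ≡⟨ ∑mod-cong m (λ i → ∑mod-*ˡ n (f i) _) ⟩
  ∑mod m (λ i → f i * ∑mod n (λ j → g (i +ᶻ + m *ᶻ j)))
    ≡⟨ ∑mod-cong m (λ i → cong (f i *_) (inner i)) ⟩
  ∑mod m (λ i → f i * ∑mod n g)
    ≡⟨ ∑mod-*ʳ m _ f ⟩
  ∑mod m f * ∑mod n g
    ∎
  where
  open ≡-Reasoning
  u = proj₁ (coprime⇒inverse c)
  -- Since `m` is invertible modulo `n`, for fixed `i` the map j ↦ i + m j runs through all residues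
  -- modulo `n`.
  inner : ∀ i → ∑mod n (λ j → g (i +ᶻ + m *ᶻ j)) ≡ ∑mod n g
  inner i = trans
    (∑mod-scale n {λ x → g (i +ᶻ x)} (+ m) u (proj₂ (coprime⇒inverse c)) (pg ∘ +-congˡ i))
    (trans (∑mod-cong n (λ x → cong g (ℤ.+-comm i x))) (∑mod-translate n i pg))

-- Let m u ≡ 1 modulo `n` and d = x - y. In d = d m u - (m u - 1) d the first term is divisible by n
-- m because n divides d, the second because n divides m u - 1 and m divides d.
≈-coprime : ∀ {m n} → Coprime m n → ∀ {x y} → x ≈ y [ m ] → x ≈ y [ n ] → x ≈ y [ n * m ]
≈-coprime {m} {n} c {x} {y} (≈-by (divides q eq)) (≈-by (divides r eq′))
  with u , ≈-by (divides s eq″) ← coprime⇒inverse c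
  = ≈-by (divides (r *ᶻ u -ᶻ s *ᶻ q) (begin
  x -ᶻ y                                                          ≡⟨ eq₁ (x -ᶻ y) (+ m) u ⟩
  (x -ᶻ y) *ᶻ + m *ᶻ u -ᶻ (+ m *ᶻ u -ᶻ 1ℤ) *ᶻ (x -ᶻ y)            ≡⟨ cong₂ (λ k l → k *ᶻ + m *ᶻ u -ᶻ (+ m *ᶻ u -ᶻ 1ℤ) *ᶻ l) eq′ eq ⟩
  (r *ᶻ + n) *ᶻ + m *ᶻ u -ᶻ (+ m *ᶻ u -ᶻ 1ℤ) *ᶻ (q *ᶻ + m)        ≡⟨ cong (λ k → (r *ᶻ + n) *ᶻ + m *ᶻ u -ᶻ k *ᶻ (q *ᶻ + m)) eq″ ⟩
  (r *ᶻ + n) *ᶻ + m *ᶻ u -ᶻ (s *ᶻ + n) *ᶻ (q *ᶻ + m)              ≡⟨ eq₂ r (+ n) (+ m) u s q ⟩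
  (r *ᶻ u -ᶻ s *ᶻ q) *ᶻ (+ n *ᶻ + m)                              ≡⟨ cong ((r *ᶻ u -ᶻ s *ᶻ q) *ᶻ_) (ℤ.pos-* n m) ⟨
  (r *ᶻ u -ᶻ s *ᶻ q) *ᶻ + (n * m)                                 ∎))
  where
  open ≡-Reasoning
  eq₁ : ∀ d m u → d ≡ d *ᶻ m *ᶻ u -ᶻ (m *ᶻ u -ᶻ 1ℤ) *ᶻ d
  eq₁ = solve-∀
  eq₂ : ∀ r n m u s q → (r *ᶻ n) *ᶻ m *ᶻ u -ᶻ (s *ᶻ n) *ᶻ (q *ᶻ m) ≡ (r *ᶻ u -ᶻ s *ᶻ q) *ᶻ (n *ᶻ m)
  eq₂ = solve-∀

≈-factorˡ : ∀ m n {x y} → x ≈ y [ n * m ] → x ≈ y [ n ]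
≈-factorˡ m n = ≈-divisor (divides (+ m) (trans (cong +_ (ℕ.*-comm n m)) (ℤ.pos-* m n)))

≈-factorʳ : ∀ m n {x y} → x ≈ y [ n * m ] → x ≈ y [ m ]
≈-factorʳ m n = ≈-divisor (divides (+ n) (ℤ.pos-* n m))

-- Units and square roots modulo n

-- The inverse is an arbitrary integer rather than an element of `Fin n`, so that products and
-- changes of modulus involve no reduction to representatives. `edge⇒unitSquare` and
-- `unitSquare⇒edge` translate from and to `IsUnit`.
record Unit (n : ℕ) (x : ℤ) : Set where
  constructor unit
  field
    inverse  : ℤ
    inverseʳ : x *ᶻ inverse ≈ 1ℤ [ n ]

module _ {n : ℕ} where

  unit-1 : Unit n 1ℤ
  unit-1 = unit 1ℤ ≈-refl

  unit-resp : Respects n (Unit n)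
  unit-resp p (unit b inv) = unit b (≈-trans (*-congʳ b (≈-sym p)) inv)

  unit-* : ∀ {x y} → Unit n x → Unit n y → Unit n (x *ᶻ y)
  unit-* {x} {y} (unit b xb≈1) (unit c yc≈1) =
    unit (b *ᶻ c) (≈-trans (≈-reflexive (eq x y b c)) (*-cong xb≈1 yc≈1))
    where
    eq : ∀ x y b c → x *ᶻ y *ᶻ (b *ᶻ c) ≡ x *ᶻ b *ᶻ (y *ᶻ c)
    eq = solve-∀

  unit-factorˡ : ∀ x y → Unit n (x *ᶻ y) → Unit n x
  unit-factorˡ x y (unit b inv) = unit (y *ᶻ b) (≈-trans (≈-reflexive (sym (ℤ.*-assoc x y b))) inv)

  unit-factorʳ : ∀ x y → Unit n (x *ᶻ y) → Unit n y
  unit-factorʳ x y u = unit-factorˡ y x (subst (Unit n) (ℤ.*-comm x y) u)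

  unit-cancelˡ : ∀ {x y} k → Unit n k → k *ᶻ x ≈ k *ᶻ y [ n ] → x ≈ y [ n ]
  unit-cancelˡ {x} {y} k (unit b inv) p = ≈-lin₂ b (y -ᶻ x) p inv (eq x y k b)
    where
    eq : ∀ x y k b → x -ᶻ y ≡ b *ᶻ (k *ᶻ x -ᶻ k *ᶻ y) +ᶻ (y -ᶻ x) *ᶻ (k *ᶻ b -ᶻ 1ℤ)
    eq = solve-∀

  ∑mod-periodic : ∀ m (f : ℤ → ℤ → ℕ) → (∀ y → Periodic n (λ x → f x y)) → Periodic n (λ x → ∑mod m (f x))
  ∑mod-periodic m f pf p = ∑mod-cong m (λ y → pf y p)

unit-factors : ∀ m n {x} → Unit (n * m) x → Unit m x × Unit n x
unit-factors m n (unit b inv) = unit b (≈-factorʳ m n inv) , unit b (≈-factorˡ m n inv)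

-- (xb - 1)(xc - 1) is divisible by both moduli at once.
unit-product : ∀ m n {x} → Unit m x → Unit n x → Unit (n * m) x
unit-product m n {x} (unit b (≈-by (divides q eq))) (unit c (≈-by (divides r eq′))) =
  unit (b +ᶻ c -ᶻ x *ᶻ b *ᶻ c) (≈-by (divides (-ᶻ (r *ᶻ q)) (begin
    x *ᶻ (b +ᶻ c -ᶻ x *ᶻ b *ᶻ c) -ᶻ 1ℤ             ≡⟨ eq₁ x b c ⟩
    -ᶻ ((x *ᶻ c -ᶻ 1ℤ) *ᶻ (x *ᶻ b -ᶻ 1ℤ))          ≡⟨ cong₂ (λ k l → -ᶻ (k *ᶻ l)) eq′ eq ⟩
    -ᶻ ((r *ᶻ + n) *ᶻ (q *ᶻ + m))                  ≡⟨ eq₂ r (+ n) q (+ m) ⟩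
    -ᶻ (r *ᶻ q) *ᶻ (+ n *ᶻ + m)                    ≡⟨ cong (-ᶻ (r *ᶻ q) *ᶻ_) (ℤ.pos-* n m) ⟨
    -ᶻ (r *ᶻ q) *ᶻ + (n * m)                       ∎)))
  where
  open ≡-Reasoning
  eq₁ : ∀ x b c → x *ᶻ (b +ᶻ c -ᶻ x *ᶻ b *ᶻ c) -ᶻ 1ℤ ≡ -ᶻ ((x *ᶻ c -ᶻ 1ℤ) *ᶻ (x *ᶻ b -ᶻ 1ℤ))
  eq₁ = solve-∀
  eq₂ : ∀ r n q m → -ᶻ ((r *ᶻ n) *ᶻ (q *ᶻ m)) ≡ -ᶻ (r *ᶻ q) *ᶻ (n *ᶻ m)
  eq₂ = solve-∀

module Counting (n : ℕ) .{{_ : NonZero n}} where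

  opaque

    unit? : ∀ x → Dec (Unit n x)
    unit? x = map′ (λ (b , p) → unit b p) (λ (unit b p) → b , p)
      (∃? {n} {P = λ b → x *ᶻ b ≈ 1ℤ [ n ]} (λ b≈c p → ≈-trans (*-congˡ x (≈-sym b≈c)) p) (λ b → x *ᶻ b ≈? 1ℤ [ n ]))

  υ : ℤ → ℕ
  υ x = 𝟙 (unit? x)

  υ-periodic : Periodic n υ
  υ-periodic = 𝟙-periodic unit? unit-resp

  υ-unit : ∀ {x} → Unit n x → υ x ≡ 1
  υ-unit {x} = 𝟙-yes (unit? x)

  υ-* : ∀ x y → υ (x *ᶻ y) ≡ υ x * υ y
  υ-* x y = trans
    (𝟙-cong (unit? (x *ᶻ y)) (unit? x ×-dec unit? y)
      (λ u → unit-factorˡ x y u , unit-factorʳ x y u) (λ (u , v) → unit-* u v))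
    (𝟙-× (unit? x) (unit? y))

  υ-associate : ∀ k {x y} → Unit n k → k *ᶻ x ≈ y [ n ] → υ x ≡ υ y
  υ-associate k {x} {y} u p = begin
    υ x           ≡⟨ ℕ.*-identityˡ (υ x) ⟨
    1 * υ x       ≡⟨ cong (_* υ x) (υ-unit u) ⟨
    υ k * υ x     ≡⟨ υ-* k x ⟨
    υ (k *ᶻ x)    ≡⟨ υ-periodic p ⟩
    υ y           ∎
    where open ≡-Reasoning

  φ : ℕ
  φ = ∑mod n υ

  -- A solution of x² = 1 is its own inverse, so this number agrees with `#√ 1ℤ`.
  #√1 : ℕ
  #√1 = ∑mod n (λ x → 𝟙 (x *ᶻ x ≈? 1ℤ [ n ]))

  -- The indicator of t(t⁴ - 1) being a unit.
  α : ℤ → ℕ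
  α t = υ t * (υ (t *ᶻ t -ᶻ 1ℤ) * υ (t *ᶻ t +ᶻ 1ℤ))

  UnitSquare : ℤ → Set
  UnitSquare u = ∃ λ a → Unit n a × u ≈ a *ᶻ a [ n ]

  unitSquare-resp : Respects n UnitSquare
  unitSquare-resp p (a , unit-a , q) = a , unit-a , ≈-trans (≈-sym p) q

  opaque

    unitSquare? : ∀ u → Dec (UnitSquare u)
    unitSquare? u = ∃? {n} {P = λ a → Unit n a × u ≈ a *ᶻ a [ n ]}
      (λ a≈b (unit-a , p) → unit-resp a≈b unit-a , ≈-trans p (*-cong a≈b a≈b))
      (λ a → unit? a ×-dec u ≈? a *ᶻ a [ n ])

  σ : ℤ → ℕ
  σ u = 𝟙 (unitSquare? u)

  σ-periodic : Periodic n σ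
  σ-periodic = 𝟙-periodic unitSquare? unitSquare-resp

  #√ : ℤ → ℕ
  #√ u = ∑mod n (λ a → υ a * 𝟙 (u ≈? a *ᶻ a [ n ]))

  𝟙-≈-periodicˡ : ∀ y → Periodic n (λ x → 𝟙 (x ≈? y [ n ]))
  𝟙-≈-periodicˡ y = 𝟙-periodic (λ x → x ≈? y [ n ]) (λ p → ≈-trans (≈-sym p))

  𝟙-≈-periodicʳ : ∀ x → Periodic n (λ y → 𝟙 (x ≈? y [ n ]))
  𝟙-≈-periodicʳ x = 𝟙-periodic (λ y → x ≈? y [ n ]) (λ p q → ≈-trans q p)

  #√-periodic : Periodic n #√
  #√-periodic = ∑mod-periodic n (λ u a → υ a * 𝟙 (u ≈? a *ᶻ a [ n ])) (λ a p → cong (υ a *_) (𝟙-≈-periodicˡ (a *ᶻ a) p))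

  #√-summand-periodic : ∀ u → Periodic n (λ a → υ a * 𝟙 (u ≈? a *ᶻ a [ n ]))
  #√-summand-periodic u = *-periodic {f = υ} {g = λ a → 𝟙 (u ≈? a *ᶻ a [ n ])} υ-periodic (λ p → 𝟙-≈-periodicʳ u (*-cong p p))

  #√-nonsquare : ∀ {u} → ¬ UnitSquare u → #√ u ≡ 0
  #√-nonsquare {u} ¬sq = begin
    #√ u                                         ≡⟨ ∑mod-cong n (λ a → trans (sym (𝟙-× (unit? a) (u ≈? a *ᶻ a [ n ]))) (𝟙-no (unit? a ×-dec u ≈? a *ᶻ a [ n ]) (λ p → ¬sq (a , p)))) ⟩
    ∑mod n (λ _ → 0)                             ≡⟨ trans (∑mod-const n 0) (ℕ.*-zeroʳ n) ⟩
    0                                            ∎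
    where open ≡-Reasoning

  -- Multiplication by one fixed root `a` of `u` carries the solutions of x² = 1 bijectively onto
  -- the roots of `u`.
  #√-square : ∀ {u} → UnitSquare u → #√ u ≡ #√1
  #√-square {u} (a , unit-a@(unit a⁻¹ inv) , u≈a²) = begin
    #√ u                                         ≡⟨ ∑mod-scale n a a⁻¹ inv (#√-summand-periodic u) ⟨
    ∑mod n (λ x → υ (a *ᶻ x) * 𝟙 (u ≈? a *ᶻ x *ᶻ (a *ᶻ x) [ n ]))
      ≡⟨ ∑mod-cong n (λ x → trans (sym (𝟙-× (unit? (a *ᶻ x)) (u ≈? a *ᶻ x *ᶻ (a *ᶻ x) [ n ])))
           (𝟙-cong (unit? (a *ᶻ x) ×-dec u ≈? a *ᶻ x *ᶻ (a *ᶻ x) [ n ]) (x *ᶻ x ≈? 1ℤ [ n ]) (to x ∘ proj₂) (from x))) ⟩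
    #√1                                          ∎
    where
    open ≡-Reasoning
    eq₁ : ∀ a x → a *ᶻ a *ᶻ (x *ᶻ x) ≡ a *ᶻ x *ᶻ (a *ᶻ x)
    eq₁ = solve-∀
    to : ∀ x → u ≈ a *ᶻ x *ᶻ (a *ᶻ x) [ n ] → x *ᶻ x ≈ 1ℤ [ n ]
    to x p = unit-cancelˡ (a *ᶻ a) (unit-* unit-a unit-a)
      (≈-trans (≈-reflexive (eq₁ a x)) (≈-trans (≈-sym p) (≈-trans u≈a² (≈-reflexive (sym (ℤ.*-identityʳ (a *ᶻ a)))))))
    from : ∀ x → x *ᶻ x ≈ 1ℤ [ n ] → Unit n (a *ᶻ x) × u ≈ a *ᶻ x *ᶻ (a *ᶻ x) [ n ]
    from x p = unit-* unit-a (unit x p) ,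
      ≈-trans u≈a² (≈-trans (≈-reflexive (sym (ℤ.*-identityʳ (a *ᶻ a))))
        (≈-trans (*-congˡ (a *ᶻ a) (≈-sym p)) (≈-reflexive (eq₁ a x))))

  #√≡σ*#√1 : ∀ u → #√ u ≡ σ u * #√1
  #√≡σ*#√1 u = 𝟙-cases (unitSquare? u) #√-square #√-nonsquare

  -- Double counting of the pairs (u , a) with u = a²: for each unit `a` the inner sum over `u`
  -- retains only the term at a². A sum over squares weighted by their roots thus becomes a free sum
  -- over units.
  ∑mod-#√ : ∀ {h} → Periodic n h → ∑mod n (λ u → #√ u * h u) ≡ ∑mod n (λ a → υ a * h (a *ᶻ a))
  ∑mod-#√ {h} ph = begin
    ∑mod n (λ u → #√ u * h u)
      ≡⟨ ∑mod-cong n (λ u → sym (∑mod-*ʳ n (h u) (λ a → υ a * 𝟙 (u ≈? a *ᶻ a [ n ])))) ⟩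
    ∑mod n (λ u → ∑mod n (λ a → υ a * 𝟙 (u ≈? a *ᶻ a [ n ]) * h u))
      ≡⟨ ∑mod-comm n n (λ u a → υ a * 𝟙 (u ≈? a *ᶻ a [ n ]) * h u) ⟩
    ∑mod n (λ a → ∑mod n (λ u → υ a * 𝟙 (u ≈? a *ᶻ a [ n ]) * h u))
      ≡⟨ ∑mod-cong n (λ a → ∑mod-cong n (λ u → ℕ.*-assoc (υ a) (𝟙 (u ≈? a *ᶻ a [ n ])) (h u))) ⟩
    ∑mod n (λ a → ∑mod n (λ u → υ a * (𝟙 (u ≈? a *ᶻ a [ n ]) * h u)))
      ≡⟨ ∑mod-cong n (λ a → ∑mod-*ˡ n (υ a) (λ u → 𝟙 (u ≈? a *ᶻ a [ n ]) * h u)) ⟩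
    ∑mod n (λ a → υ a * ∑mod n (λ u → 𝟙 (u ≈? a *ᶻ a [ n ]) * h u))
      ≡⟨ ∑mod-cong n (λ a → cong (υ a *_) (∑mod-𝟙-≈ n (a *ᶻ a) ph)) ⟩
    ∑mod n (λ a → υ a * h (a *ᶻ a))
      ∎
    where open ≡-Reasoning

  -- Squaring maps the units onto the unit squares, and all its fibres have `#√1` elements.
  ∑σ*#√1≡φ : ∑mod n σ * #√1 ≡ φ
  ∑σ*#√1≡φ = begin
    ∑mod n σ * #√1                ≡⟨ ∑mod-*ʳ n #√1 σ ⟨
    ∑mod n (λ u → σ u * #√1)      ≡⟨ ∑mod-cong n (λ u → trans (sym (#√≡σ*#√1 u)) (sym (ℕ.*-identityʳ (#√ u)))) ⟩
    ∑mod n (λ u → #√ u * 1)       ≡⟨ ∑mod-#√ {λ _ → 1} (λ _ → refl) ⟩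
    ∑mod n (λ a → υ a * 1)        ≡⟨ ∑mod-cong n (λ a → ℕ.*-identityʳ (υ a)) ⟩
    φ                             ∎
    where open ≡-Reasoning

  #triangles : ℕ
  #triangles = ∑mod n (λ x → ∑mod n (λ y → ∑mod n (λ z → σ (x -ᶻ y) * (σ (y -ᶻ z) * σ (x -ᶻ z)))))

  #triples : ℤ → ℕ
  #triples b = ∑mod n (λ a → υ a * ∑mod n (λ c → υ c * 𝟙 (a *ᶻ a +ᶻ b *ᶻ b ≈? c *ᶻ c [ n ])))

  ∑∑σσσ : ℕ
  ∑∑σσσ = ∑mod n (λ u → ∑mod n (λ v → σ u * (σ v * σ (u +ᶻ v))))

  -- Since x - z = (x - y) + (y - z), the summand depends only on u = x - y and v = y - z. For fixed
  -- x and y the substitution z ↦ y - z is its own inverse; the vertex y then remains free and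
  -- contributes the factor `n`.
  #triangles≡n*∑∑σσσ : #triangles ≡ n * ∑∑σσσ
  #triangles≡n*∑∑σσσ = begin
    #triangles
      ≡⟨ ∑mod-comm n n (λ x y → ∑mod n (λ z → σ (x -ᶻ y) * (σ (y -ᶻ z) * σ (x -ᶻ z)))) ⟩
    ∑mod n (λ y → ∑mod n (λ x → ∑mod n (λ z → σ (x -ᶻ y) * (σ (y -ᶻ z) * σ (x -ᶻ z)))))
      ≡⟨ ∑mod-cong n (λ y → ∑mod-cong n (λ x → shift-z x y)) ⟩
    ∑mod n (λ y → ∑mod n (λ x → f (x -ᶻ y)))
      ≡⟨ ∑mod-cong n (λ y → ∑mod-translate n (-ᶻ y) f-periodic) ⟩
    ∑mod n (λ y → ∑mod n f)
      ≡⟨ ∑mod-const n (∑mod n f) ⟩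
    n * ∑∑σσσ
      ∎
    where
    open ≡-Reasoning
    f : ℤ → ℕ
    f u = ∑mod n (λ v → σ u * (σ v * σ (u +ᶻ v)))
    f-periodic : Periodic n f
    f-periodic = ∑mod-periodic n (λ u v → σ u * (σ v * σ (u +ᶻ v)))
      (λ v → *-periodic {f = σ} {g = λ u → σ v * σ (u +ᶻ v)} σ-periodic (λ p → cong (σ v *_) (σ-periodic (+-congʳ v p))))
    eq₁ : ∀ x y → y -ᶻ (y -ᶻ x) ≡ x
    eq₁ = solve-∀
    eq₂ : ∀ x y z → x -ᶻ z ≡ (x -ᶻ y) +ᶻ (y -ᶻ z)
    eq₂ = solve-∀
    shift-z : ∀ x y → ∑mod n (λ z → σ (x -ᶻ y) * (σ (y -ᶻ z) * σ (x -ᶻ z))) ≡ f (x -ᶻ y)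
    shift-z x y = trans
      (∑mod-cong n (λ z → cong (λ s → σ (x -ᶻ y) * (σ (y -ᶻ z) * σ s)) (eq₂ x y z)))
      (∑mod-reindex n {λ v → σ (x -ᶻ y) * (σ v * σ ((x -ᶻ y) +ᶻ v))} (λ z → y -ᶻ z) (λ v → y -ᶻ v)
        (λ p → cong (σ (x -ᶻ y) *_) (*-periodic {f = σ} {g = λ v → σ ((x -ᶻ y) +ᶻ v)} σ-periodic (σ-periodic ∘ +-congˡ (x -ᶻ y)) p))
        (+-congˡ y ∘ neg-cong) (+-congˡ y ∘ neg-cong)
        (λ v → ≈-reflexive (eq₁ v y)) (λ v → ≈-reflexive (eq₁ v y)))

  #√1³*∑∑σσσ : #√1 ^ 3 * ∑∑σσσ ≡ ∑mod n (λ b → υ b * #triples b)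
  #√1³*∑∑σσσ = begin
    #√1 ^ 3 * ∑∑σσσ
      ≡⟨ ∑mod-*ˡ n (#√1 ^ 3) _ ⟨
    ∑mod n (λ u → #√1 ^ 3 * ∑mod n (λ v → σ u * (σ v * σ (u +ᶻ v))))
      ≡⟨ ∑mod-cong n (λ u → sym (∑mod-*ˡ n (#√1 ^ 3) _)) ⟩
    ∑mod n (λ u → ∑mod n (λ v → #√1 ^ 3 * (σ u * (σ v * σ (u +ᶻ v)))))
      ≡⟨ ∑mod-cong n (λ u → ∑mod-cong n (λ v → spread u v)) ⟩
    ∑mod n (λ u → ∑mod n (λ v → #√ u * (#√ v * #√ (u +ᶻ v))))
      ≡⟨ ∑mod-cong n (λ u → ∑mod-*ˡ n (#√ u) _) ⟩
    ∑mod n (λ u → #√ u * ∑mod n (λ v → #√ v * #√ (u +ᶻ v)))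
      -- With u fixed, v is replaced by b²; the next step replaces u by a² in the same way.
      ≡⟨ ∑mod-cong n (λ u → cong (#√ u *_) (∑mod-#√ (#√-periodic ∘ +-congˡ u))) ⟩
    ∑mod n (λ u → #√ u * ∑mod n (λ b → υ b * #√ (u +ᶻ b *ᶻ b)))
      ≡⟨ ∑mod-#√ (∑mod-periodic n (λ u b → υ b * #√ (u +ᶻ b *ᶻ b)) (λ b p → cong (υ b *_) (#√-periodic (+-congʳ (b *ᶻ b) p)))) ⟩
    ∑mod n (λ a → υ a * ∑mod n (λ b → υ b * #√ (a *ᶻ a +ᶻ b *ᶻ b)))
      ≡⟨ ∑mod-cong n (λ a → sym (∑mod-*ˡ n (υ a) _)) ⟩
    ∑mod n (λ a → ∑mod n (λ b → υ a * (υ b * #√ (a *ᶻ a +ᶻ b *ᶻ b))))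
      -- `b` becomes the outer variable, because it will be normalised to 1 for each unit `b`
      -- separately.
      ≡⟨ ∑mod-comm n n (λ a b → υ a * (υ b * #√ (a *ᶻ a +ᶻ b *ᶻ b))) ⟩
    ∑mod n (λ b → ∑mod n (λ a → υ a * (υ b * #√ (a *ᶻ a +ᶻ b *ᶻ b))))
      ≡⟨ ∑mod-cong n (λ b → ∑mod-cong n (λ a → swap (υ a) (υ b) (#√ (a *ᶻ a +ᶻ b *ᶻ b)))) ⟩
    ∑mod n (λ b → ∑mod n (λ a → υ b * (υ a * #√ (a *ᶻ a +ᶻ b *ᶻ b))))
      ≡⟨ ∑mod-cong n (λ b → ∑mod-*ˡ n (υ b) _) ⟩
    ∑mod n (λ b → υ b * #triples b)
      ∎
    where
    open ≡-Reasoning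
    swap : ∀ x y z → x * (y * z) ≡ y * (x * z)
    swap = ℕ-solve-∀
    cube : ∀ r x y z → r * (r * (r * 1)) * (x * (y * z)) ≡ x * r * (y * r * (z * r))
    cube = ℕ-solve-∀
    spread : ∀ u v → #√1 ^ 3 * (σ u * (σ v * σ (u +ᶻ v))) ≡ #√ u * (#√ v * #√ (u +ᶻ v))
    spread u v = trans (cube #√1 (σ u) (σ v) (σ (u +ᶻ v)))
      (sym (cong₂ _*_ (#√≡σ*#√1 u) (cong₂ _*_ (#√≡σ*#√1 v) (#√≡σ*#√1 (u +ᶻ v)))))

  -- The equation is homogeneous of degree two and scaling by `b` preserves units, so (a , c) solves
  -- it with 1 exactly when (b a , b c) solves it with `b`. Both summation variables are rescaled.
  #triples-unit : ∀ b → Unit n b → #triples b ≡ #triples 1ℤ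
  #triples-unit b unit-b@(unit b⁻¹ inv) = begin
    #triples b
      ≡⟨ ∑mod-scale n {λ a → υ a * ∑mod n (g a)} b b⁻¹ inv (*-periodic {f = υ} {g = λ a → ∑mod n (g a)} υ-periodic (∑mod-periodic n g
           (λ c p → cong (υ c *_) (𝟙-≈-periodicˡ (c *ᶻ c) (+-congʳ (b *ᶻ b) (*-cong p p)))))) ⟨
    ∑mod n (λ a → υ (b *ᶻ a) * ∑mod n (g (b *ᶻ a)))
      ≡⟨ ∑mod-cong n (λ a → cong (υ (b *ᶻ a) *_) (sym (∑mod-scale n {g (b *ᶻ a)} b b⁻¹ inv (#√-summand-periodic _)))) ⟩
    ∑mod n (λ a → υ (b *ᶻ a) * ∑mod n (λ c → g (b *ᶻ a) (b *ᶻ c)))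
      ≡⟨ ∑mod-cong n (λ a → cong₂ _*_ (υ-b a) (∑mod-cong n (λ c → cong₂ _*_ (υ-b c) (equation a c)))) ⟩
    #triples 1ℤ
      ∎
    where
    open ≡-Reasoning
    g : ℤ → ℤ → ℕ
    g a c = υ c * 𝟙 (a *ᶻ a +ᶻ b *ᶻ b ≈? c *ᶻ c [ n ])
    υ-b : ∀ x → υ (b *ᶻ x) ≡ υ x
    υ-b x = sym (υ-associate b unit-b ≈-refl)
    eq₁ : ∀ a b → b *ᶻ b *ᶻ (a *ᶻ a +ᶻ 1ℤ) ≡ b *ᶻ a *ᶻ (b *ᶻ a) +ᶻ b *ᶻ b
    eq₁ = solve-∀
    eq₂ : ∀ c b → b *ᶻ b *ᶻ (c *ᶻ c) ≡ b *ᶻ c *ᶻ (b *ᶻ c)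
    eq₂ = solve-∀
    equation : ∀ a c → 𝟙 (b *ᶻ a *ᶻ (b *ᶻ a) +ᶻ b *ᶻ b ≈? b *ᶻ c *ᶻ (b *ᶻ c) [ n ]) ≡ 𝟙 (a *ᶻ a +ᶻ 1ℤ ≈? c *ᶻ c [ n ])
    equation a c = 𝟙-cong (b *ᶻ a *ᶻ (b *ᶻ a) +ᶻ b *ᶻ b ≈? b *ᶻ c *ᶻ (b *ᶻ c) [ n ]) (a *ᶻ a +ᶻ 1ℤ ≈? c *ᶻ c [ n ])
      (λ p → unit-cancelˡ (b *ᶻ b) (unit-* unit-b unit-b)
        (≈-trans (≈-reflexive (eq₁ a b)) (≈-trans p (≈-reflexive (sym (eq₂ c b))))))
      (λ p → ≈-trans (≈-reflexive (sym (eq₁ a b))) (≈-trans (*-congˡ (b *ᶻ b) p) (≈-reflexive (eq₂ c b))))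

  -- With t = a + c the equation a² + 1 = c² reads t (t - 2a) = 1, so t is a
  -- unit, 2a = t - 1/t and 2c = t + 1/t.
  #triples-1 : Unit n (+ 2) → #triples 1ℤ ≡ ∑mod n α
  #triples-1 unit-2@(unit ½ 2*½≈1) = begin
    #triples 1ℤ
      ≡⟨ ∑mod-cong n (λ a → sym (∑mod-*ˡ n (υ a) (λ c → υ c * 𝟙 (a *ᶻ a +ᶻ 1ℤ ≈? c *ᶻ c [ n ])))) ⟩
    ∑mod n (λ a → ∑mod n (λ c → H a c))
      ≡⟨ ∑mod-cong n (λ a → sym (∑mod-translate n {H a} (-ᶻ a) (λ p → cong (υ a *_) (#√-summand-periodic (a *ᶻ a +ᶻ 1ℤ) p)))) ⟩
    ∑mod n (λ a → ∑mod n (λ t → H a (t -ᶻ a)))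
      ≡⟨ ∑mod-comm n n (λ a t → H a (t -ᶻ a)) ⟩
    ∑mod n (λ t → ∑mod n (λ a → H a (t -ᶻ a)))
      ≡⟨ ∑mod-cong n (λ t → ∑mod-cong n (λ a → rearrange t a)) ⟩
    ∑mod n (λ t → ∑mod n (λ a → K t a))
      ≡⟨ ∑mod-cong n inner ⟩
    ∑mod n α
      ∎
    where
    open ≡-Reasoning
    H : ℤ → ℤ → ℕ
    H a c = υ a * (υ c * 𝟙 (a *ᶻ a +ᶻ 1ℤ ≈? c *ᶻ c [ n ]))

    K : ℤ → ℤ → ℕ
    K t a = 𝟙 (t *ᶻ (t -ᶻ + 2 *ᶻ a) ≈? 1ℤ [ n ]) * (υ a * υ (t -ᶻ a))

    rearrange : ∀ t a → H a (t -ᶻ a) ≡ K t a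
    rearrange t a = trans
      (cong (λ i → υ a * (υ (t -ᶻ a) * i))
        (𝟙-cong (a *ᶻ a +ᶻ 1ℤ ≈? (t -ᶻ a) *ᶻ (t -ᶻ a) [ n ]) (t *ᶻ (t -ᶻ + 2 *ᶻ a) ≈? 1ℤ [ n ])
          (λ p → ≈-lin -1ℤ p (eq₁ t a)) (λ p → ≈-lin -1ℤ p (eq₂ t a))))
      (rotate (υ a) (υ (t -ᶻ a)) _)
      where
      rotate : ∀ x y z → x * (y * z) ≡ z * (x * y)
      rotate = ℕ-solve-∀
      eq₁ : ∀ t a → t *ᶻ (t -ᶻ + 2 *ᶻ a) -ᶻ 1ℤ ≡ -1ℤ *ᶻ (a *ᶻ a +ᶻ 1ℤ -ᶻ (t -ᶻ a) *ᶻ (t -ᶻ a))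
      eq₁ = solve-∀
      eq₂ : ∀ t a → a *ᶻ a +ᶻ 1ℤ -ᶻ (t -ᶻ a) *ᶻ (t -ᶻ a) ≡ -1ℤ *ᶻ (t *ᶻ (t -ᶻ + 2 *ᶻ a) -ᶻ 1ℤ)
      eq₂ = solve-∀

    inner-unit : ∀ t → Unit n t → ∑mod n (λ a → K t a) ≡ υ (t *ᶻ t -ᶻ 1ℤ) * υ (t *ᶻ t +ᶻ 1ℤ)
    inner-unit t unit-t@(unit t⁻¹ inv) = begin
      ∑mod n (λ a → K t a)
        ≡⟨ ∑mod-cong n (λ a → cong (_* (υ a * υ (t -ᶻ a)))
             (𝟙-cong (t *ᶻ (t -ᶻ + 2 *ᶻ a) ≈? 1ℤ [ n ]) (a ≈? a₀ [ n ]) (to a) (from a))) ⟩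
      ∑mod n (λ a → 𝟙 (a ≈? a₀ [ n ]) * (υ a * υ (t -ᶻ a)))
        ≡⟨ ∑mod-𝟙-≈ n a₀ (*-periodic {f = υ} {g = λ a → υ (t -ᶻ a)} υ-periodic (υ-periodic ∘ +-congˡ t ∘ neg-cong)) ⟩
      υ a₀ * υ (t -ᶻ a₀)
        -- The unit 2t clears denominators: 2t a₀ ≡ t² - 1 and 2t (t - a₀) ≡ t² + 1.
        ≡⟨ cong₂ _*_ (υ-associate (+ 2 *ᶻ t) (unit-* unit-2 unit-t) (≈-lin₂ (t *ᶻ (t -ᶻ t⁻¹)) -1ℤ 2*½≈1 inv (eq₁ t t⁻¹ ½)))
                     (υ-associate (+ 2 *ᶻ t) (unit-* unit-2 unit-t) (≈-lin₂ (t *ᶻ (t⁻¹ -ᶻ t)) 1ℤ 2*½≈1 inv (eq₂ t t⁻¹ ½))) ⟩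
      υ (t *ᶻ t -ᶻ 1ℤ) * υ (t *ᶻ t +ᶻ 1ℤ)
        ∎
      where
      a₀ = ½ *ᶻ (t -ᶻ t⁻¹)
      eq₁ : ∀ t s h → + 2 *ᶻ t *ᶻ (h *ᶻ (t -ᶻ s)) -ᶻ (t *ᶻ t -ᶻ 1ℤ)
            ≡ t *ᶻ (t -ᶻ s) *ᶻ (+ 2 *ᶻ h -ᶻ 1ℤ) +ᶻ -1ℤ *ᶻ (t *ᶻ s -ᶻ 1ℤ)
      eq₁ = solve-∀
      eq₂ : ∀ t s h → + 2 *ᶻ t *ᶻ (t -ᶻ h *ᶻ (t -ᶻ s)) -ᶻ (t *ᶻ t +ᶻ 1ℤ)
            ≡ t *ᶻ (s -ᶻ t) *ᶻ (+ 2 *ᶻ h -ᶻ 1ℤ) +ᶻ 1ℤ *ᶻ (t *ᶻ s -ᶻ 1ℤ)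
      eq₂ = solve-∀
      eq₃ : ∀ a t s h → + 2 *ᶻ t *ᶻ a -ᶻ + 2 *ᶻ t *ᶻ (h *ᶻ (t -ᶻ s))
            ≡ 1ℤ *ᶻ (t *ᶻ s -ᶻ t *ᶻ (t -ᶻ + 2 *ᶻ a)) +ᶻ t *ᶻ (s -ᶻ t) *ᶻ (+ 2 *ᶻ h -ᶻ 1ℤ)
      eq₃ = solve-∀
      eq₄ : ∀ a t s h → t *ᶻ (t -ᶻ + 2 *ᶻ (h *ᶻ (t -ᶻ s))) -ᶻ 1ℤ
            ≡ t *ᶻ (s -ᶻ t) *ᶻ (+ 2 *ᶻ h -ᶻ 1ℤ) +ᶻ 1ℤ *ᶻ (t *ᶻ s -ᶻ 1ℤ)
      eq₄ = solve-∀
      to : ∀ a → t *ᶻ (t -ᶻ + 2 *ᶻ a) ≈ 1ℤ [ n ] → a ≈ a₀ [ n ]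
      to a p = unit-cancelˡ (+ 2 *ᶻ t) (unit-* unit-2 unit-t)
        (≈-lin₂ 1ℤ (t *ᶻ (t⁻¹ -ᶻ t)) (≈-trans inv (≈-sym p)) 2*½≈1 (eq₃ a t t⁻¹ ½))
      from : ∀ a → a ≈ a₀ [ n ] → t *ᶻ (t -ᶻ + 2 *ᶻ a) ≈ 1ℤ [ n ]
      from a p = ≈-trans (*-congˡ t (+-congˡ t (neg-cong (*-congˡ (+ 2) p))))
        (≈-lin₂ (t *ᶻ (t⁻¹ -ᶻ t)) 1ℤ 2*½≈1 inv (eq₄ a t t⁻¹ ½))

    -- The equation t (t - 2a) = 1 exhibits an inverse of `t`, so it has no solution for a nonunit.
    inner-nonunit : ∀ t → ¬ Unit n t → ∑mod n (λ a → K t a) ≡ 0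
    inner-nonunit t ¬unit-t = trans
      (∑mod-cong n (λ a → cong (_* (υ a * υ (t -ᶻ a))) (𝟙-no (t *ᶻ (t -ᶻ + 2 *ᶻ a) ≈? 1ℤ [ n ]) (λ p → ¬unit-t (unit (t -ᶻ + 2 *ᶻ a) p)))))
      (trans (∑mod-const n 0) (ℕ.*-zeroʳ n))

    inner : ∀ t → ∑mod n (λ a → K t a) ≡ α t
    inner t = 𝟙-cases (unit? t) (inner-unit t) (inner-nonunit t)

  #√1³*#triangles : Unit n (+ 2) → #√1 ^ 3 * #triangles ≡ n * (φ * ∑mod n α)
  #√1³*#triangles unit-2 = begin
    #√1 ^ 3 * #triangles                        ≡⟨ cong (#√1 ^ 3 *_) #triangles≡n*∑∑σσσ ⟩
    #√1 ^ 3 * (n * ∑∑σσσ)                       ≡⟨ swap (#√1 ^ 3) n ∑∑σσσ ⟩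
    n * (#√1 ^ 3 * ∑∑σσσ)                       ≡⟨ cong (n *_) #√1³*∑∑σσσ ⟩
    n * ∑mod n (λ b → υ b * #triples b)         ≡⟨ cong (n *_) (∑mod-cong n (λ b → 𝟙-*-cong (unit? b) (#triples-unit b))) ⟩
    n * ∑mod n (λ b → υ b * #triples 1ℤ)        ≡⟨ cong (n *_) (∑mod-*ʳ n (#triples 1ℤ) υ) ⟩
    n * (φ * #triples 1ℤ)                       ≡⟨ cong (λ k → n * (φ * k)) (#triples-1 unit-2) ⟩
    n * (φ * ∑mod n α)                          ∎
    where
    open ≡-Reasoning
    swap : ∀ x y z → x * (y * z) ≡ y * (x * z)
    swap = ℕ-solve-∀

open Counting

-- Multiplicativity

everything-≈-mod-1 : ∀ {x y} → x ≈ y [ 1 ]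
everything-≈-mod-1 {x} {y} = ≈-by (divides (x -ᶻ y) (sym (ℤ.*-identityʳ (x -ᶻ y))))

-- Multiplicativity is imposed pointwise, at the same integer `x` for all three moduli, because a
-- condition modulo `n * m` is the conjunction of the conditions modulo `m` and `n`. Summation turns
-- it into multiplicativity of the counts. `at-1` is the empty product: in the zero ring even 0 is a
-- unit and every congruence holds.
record Multiplicative (f : ∀ n .{{_ : NonZero n}} → ℤ → ℕ) : Set where
  field
    periodic : ∀ n .{{_ : NonZero n}} → Periodic n (f n)
    at-1     : f 1 0ℤ ≡ 1
    product  : ∀ m n .{{_ : NonZero m}} .{{_ : NonZero n}} .{{_ : NonZero (n * m)}} →
               Coprime m n → ∀ x → f (n * m) x ≡ f m x * f n x

υ-multiplicative : Multiplicative υ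
υ-multiplicative = record
  { periodic = υ-periodic
  ; at-1     = υ-unit 1 (unit 0ℤ everything-≈-mod-1)
  ; product  = λ m n _ x → trans
      (𝟙-cong (unit? (n * m) x) (unit? m x ×-dec unit? n x) (unit-factors m n) (λ (u , v) → unit-product m n u v))
      (𝟙-× (unit? m x) (unit? n x))
  }

α-multiplicative : Multiplicative α
α-multiplicative = record
  { periodic = λ n p → cong₂ _*_ (υ-periodic n p)
      (cong₂ _*_ (υ-periodic n (+-congʳ -1ℤ (*-cong p p))) (υ-periodic n (+-congʳ 1ℤ (*-cong p p))))
  ; at-1     = cong₂ _*_ (υ≡1 0ℤ) (cong₂ _*_ (υ≡1 -1ℤ) (υ≡1 1ℤ))
  ; product  = λ m n c x → trans
      (cong₂ _*_ (υ-product m n c x) (cong₂ _*_ (υ-product m n c (x *ᶻ x -ᶻ 1ℤ)) (υ-product m n c (x *ᶻ x +ᶻ 1ℤ))))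
      (interchange (υ m x) (υ n x) (υ m (x *ᶻ x -ᶻ 1ℤ)) (υ n (x *ᶻ x -ᶻ 1ℤ)) (υ m (x *ᶻ x +ᶻ 1ℤ)) (υ n (x *ᶻ x +ᶻ 1ℤ)))
  }
  where
  open Multiplicative υ-multiplicative using () renaming (product to υ-product)
  υ≡1 : ∀ x → υ 1 x ≡ 1
  υ≡1 x = υ-unit 1 {x} (unit 0ℤ everything-≈-mod-1)
  interchange : ∀ a b c d e f → a * b * (c * d * (e * f)) ≡ a * (c * e) * (b * (d * f))
  interchange = ℕ-solve-∀

-- The case c = 1 yields the count `#√1`; the case c = -1 carries a square root of -1 from prime
-- powers to their product.
√𝟙 : ℤ → ∀ n .{{_ : NonZero n}} → ℤ → ℕ
√𝟙 c n x = 𝟙 (x *ᶻ x ≈? c [ n ])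

√𝟙-multiplicative : ∀ c → Multiplicative (√𝟙 c)
√𝟙-multiplicative c = record
  { periodic = λ n p → 𝟙-≈-periodicˡ n c (*-cong p p)
  ; at-1     = 𝟙-yes (0ℤ ≈? c [ 1 ]) everything-≈-mod-1
  ; product  = λ m n m⊥n x → trans
      (𝟙-cong (x *ᶻ x ≈? c [ n * m ]) (x *ᶻ x ≈? c [ m ] ×-dec x *ᶻ x ≈? c [ n ])
        (λ p → ≈-factorʳ m n p , ≈-factorˡ m n p) (λ (p , q) → ≈-coprime m⊥n p q))
      (𝟙-× (x *ᶻ x ≈? c [ m ]) (x *ᶻ x ≈? c [ n ]))
  }

-- Coprimality and finite products of moduli

coprime-*ˡ : ∀ {m m′ n} → Coprime m n → Coprime m′ n → Coprime (m * m′) n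
coprime-*ˡ m⊥n m′⊥n (d∣mm′ , d∣n) =
  m′⊥n (coprime-divisor (λ (e∣d , e∣m) → m⊥n (e∣m , ℕ∣.∣-trans e∣d d∣n)) d∣mm′ , d∣n)

coprime-^ˡ : ∀ {m n} a → Coprime m n → Coprime (m ^ a) n
coprime-^ˡ {n = n} zero c = 1-coprimeTo n
coprime-^ˡ (suc a) c = coprime-*ˡ c (coprime-^ˡ a c)

coprime-^ : ∀ {m n} a b → Coprime m n → Coprime (m ^ a) (n ^ b)
coprime-^ {m} {n} a b c = coprime-^ˡ a (coprime-sym (coprime-^ˡ b (coprime-sym c)))

distinct-primes-coprime : ∀ {p q} → Prime p → Prime q → p ≢ q → Coprime p q
distinct-primes-coprime p-prime q-prime p≢q (d∣p , d∣q)
  with prime⇒irreducible p-prime d∣p | prime⇒irreducible q-prime d∣q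
... | inj₁ d≡1 | _        = d≡1
... | _        | inj₁ d≡1 = d≡1
... | inj₂ d≡p | inj₂ d≡q = contradiction (trans (sym d≡p) d≡q) p≢q

∏-coprime : ∀ {k} (N : Fin k → ℕ) {n} → (∀ i → Coprime (N i) n) → Coprime (∏ N) n
∏-coprime {zero}  N {n} c = 1-coprimeTo n
∏-coprime {suc k} N c = coprime-*ˡ (c zero) (∏-coprime (N ∘ suc) (c ∘ suc))

∏≢0 : ∀ {k} (N : Fin k → ℕ) → (∀ i → NonZero (N i)) → NonZero (∏ N)
∏≢0 {zero}  N nz = _
∏≢0 {suc k} N nz = ℕ.m*n≢0 (N zero) _ {{nz zero}} {{∏≢0 (N ∘ suc) (nz ∘ suc)}}

∏-cong : ∀ {k} {M N : Fin k → ℕ} → (∀ i → M i ≡ N i) → ∏ M ≡ ∏ N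
∏-cong {zero}  eq = refl
∏-cong {suc k} eq = cong₂ _*_ (eq zero) (∏-cong (eq ∘ suc))

∏-* : ∀ {k} (M N : Fin k → ℕ) → ∏ (λ i → M i * N i) ≡ ∏ M * ∏ N
∏-* {zero}  M N = refl
∏-* {suc k} M N = trans (cong (M zero * N zero *_) (∏-* (M ∘ suc) (N ∘ suc)))
  (interchange (M zero) (N zero) (∏ (M ∘ suc)) (∏ (N ∘ suc)))
  where
  interchange : ∀ a b c d → a * b * (c * d) ≡ a * c * (b * d)
  interchange = ℕ-solve-∀

∏-const : ∀ k c → ∏ {k} (λ _ → c) ≡ c ^ k
∏-const zero    c = refl
∏-const (suc k) c = cong (c *_) (∏-const k c)

∏-unit : ∀ {k} (N : Fin k → ℕ) {x} → (∀ i → Unit (N i) x) → Unit (∏ N) x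
∏-unit {zero}  N u = unit 0ℤ everything-≈-mod-1
∏-unit {suc k} N u = unit-product (∏ (N ∘ suc)) (N zero) (∏-unit (N ∘ suc) (u ∘ suc)) (u zero)

∑mod-∏ : ∀ {f : ∀ n .{{_ : NonZero n}} → ℤ → ℕ} → Multiplicative f →
  ∀ {k} (N : Fin k → ℕ) (nz : ∀ i → NonZero (N i)) .{{_ : NonZero (∏ N)}} →
  (∀ {i j} → i ≢ j → Coprime (N i) (N j)) →
  ∑mod (∏ N) (f (∏ N)) ≡ ∏ (λ i → ∑mod (N i) (f (N i) {{nz i}}))
∑mod-∏ {f} mult {zero}  N nz c = trans (∑mod-1 (f 1)) (Multiplicative.at-1 mult)
∑mod-∏ {f} mult {suc k} N nz {{nz-∏}} c = begin
  ∑mod (n * m) (f (n * m))                      ≡⟨ ∑mod-cong (n * m) (λ x → product m n m⊥n x) ⟩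
  ∑mod (n * m) (λ x → f m x * f n x)            ≡⟨ ∑mod-coprime m⊥n (periodic m) (periodic n) ⟩
  ∑mod m (f m) * ∑mod n (f n)                   ≡⟨ ℕ.*-comm (∑mod m (f m)) (∑mod n (f n)) ⟩
  ∑mod n (f n) * ∑mod m (f m)                   ≡⟨ cong (∑mod n (f n) *_) (∑mod-∏ mult (N ∘ suc) (nz ∘ suc) (λ i≢j → c (i≢j ∘ suc-injective))) ⟩
  ∏ (λ i → ∑mod (N i) (f (N i) {{nz i}}))       ∎
  where
  open ≡-Reasoning
  open Multiplicative mult
  m = ∏ (N ∘ suc)
  n = N zero
  instance
    m≢0 : NonZero m
    m≢0 = ∏≢0 (N ∘ suc) (nz ∘ suc)
    n≢0 : NonZero n
    n≢0 = nz zero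
  m⊥n : Coprime m n
  m⊥n = ∏-coprime (N ∘ suc) (λ i → c (λ ()))

-- Prime powers

-- The points moved by `ι` fall into pairs {i, ι i} on which `f` is constant. The order of `Fin n`
-- selects the smaller member of each pair, and `ι` itself exchanges `below` with `above`.
involution-parity : ∀ {n} (f : Fin n → ℕ) (ι : Fin n → Fin n) → (∀ i → ι (ι i) ≡ i) → (∀ i → f (ι i) ≡ f i) →
  ∃ λ c → ∑[ i < n ] f i ≡ ∑[ i < n ] (f i * 𝟙 (ι i ≟ᶠ i)) + 2 * c
involution-parity {n} f ι ι² fι = ∑[ i < n ] below i , (begin
  ∑[ i < n ] f i                                                    ≡⟨ sum-cong-≗ {n} (λ i → trichotomy i (<-cmp i (ι i))) ⟩
  ∑[ i < n ] (fixed i + (below i + above i))                        ≡⟨ ∑-distrib-+ fixed (λ i → below i + above i) ⟩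
  ∑[ i < n ] fixed i + ∑[ i < n ] (below i + above i)               ≡⟨ cong (sum fixed ℕ.+_) (∑-distrib-+ below above) ⟩
  ∑[ i < n ] fixed i + (∑[ i < n ] below i + ∑[ i < n ] above i)    ≡⟨ cong (λ s → sum fixed + (sum below + s)) above≡below ⟩
  ∑[ i < n ] fixed i + (∑[ i < n ] below i + ∑[ i < n ] below i)    ≡⟨ cong (λ s → sum fixed + (sum below + s)) (ℕ.+-identityʳ (sum below)) ⟨
  ∑[ i < n ] fixed i + 2 * ∑[ i < n ] below i                       ∎)
  where
  open ≡-Reasoning
  fixed below above : Fin n → ℕ
  fixed i = f i * 𝟙 (ι i ≟ᶠ i)
  below i = f i * 𝟙 (i <? ι i)
  above i = f i * 𝟙 (ι i <? i)

  above≡below : ∑[ i < n ] above i ≡ ∑[ i < n ] below i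
  above≡below = trans (∑-permute above (permutation ι ι ι² ι²))
    (sum-cong-≗ {n} (λ i → cong₂ _*_ (fι i) (cong (λ j → 𝟙 (j <? ι i)) (ι² i))))

  total : ∀ x {a b c} → a + (b + c) ≡ 1 → x ≡ x * a + (x * b + x * c)
  total x {a} {b} {c} eq = trans (sym (ℕ.*-identityʳ x)) (trans (cong (x *_) (sym eq)) (distrib x a b c))
    where
    distrib : ∀ x a b c → x * (a + (b + c)) ≡ x * a + (x * b + x * c)
    distrib = ℕ-solve-∀

  trichotomy : ∀ i → _ → f i ≡ fixed i + (below i + above i)
  trichotomy i (tri< i<ιi ιi≢i i≯ιi) = total (f i) (cong₂ _+_ (𝟙-no (ι i ≟ᶠ i) (ιi≢i ∘ sym)) (cong₂ _+_ (𝟙-yes (i <? ι i) i<ιi) (𝟙-no (ι i <? i) i≯ιi)))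
  trichotomy i (tri≈ i≮ιi ιi≡i i≯ιi) = total (f i) (cong₂ _+_ (𝟙-yes (ι i ≟ᶠ i) (sym ιi≡i)) (cong₂ _+_ (𝟙-no (i <? ι i) i≮ιi) (𝟙-no (ι i <? i) i≯ιi)))
  trichotomy i (tri> i≮ιi ιi≢i i>ιi) = total (f i) (cong₂ _+_ (𝟙-no (ι i ≟ᶠ i) (ιi≢i ∘ sym)) (cong₂ _+_ (𝟙-no (i <? ι i) i≮ιi) (𝟙-yes (ι i <? i) i>ιi)))

module _ (n : ℕ) .{{_ : NonZero n}} where

  private
    -- Off the units inversion is extended by the identity, which makes it an involution of all of
    -- `Fin n`.
    inv : (i : Fin n) → Dec (Unit n ⟦ i ⟧) → Fin n
    inv i (yes (unit b _)) = residue n b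
    inv i (no _)           = i

    inv-unit : ∀ i d → Unit n ⟦ i ⟧ → ⟦ i ⟧ *ᶻ ⟦ inv i d ⟧ ≈ 1ℤ [ n ]
    inv-unit i (yes (unit b p)) u = ≈-trans (*-congˡ ⟦ i ⟧ (residue-≈ n b)) p
    inv-unit i (no ¬u)          u = contradiction u ¬u

    inv-nonunit : ∀ i d → ¬ Unit n ⟦ i ⟧ → inv i d ≡ i
    inv-nonunit i (yes u) ¬u = contradiction u ¬u
    inv-nonunit i (no _)  ¬u = refl

    ι : Fin n → Fin n
    ι i = inv i (unit? n ⟦ i ⟧)

    ι-unit : ∀ i → Unit n ⟦ i ⟧ → ⟦ i ⟧ *ᶻ ⟦ ι i ⟧ ≈ 1ℤ [ n ]
    ι-unit i = inv-unit i (unit? n ⟦ i ⟧)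

    ι-nonunit : ∀ i → ¬ Unit n ⟦ i ⟧ → ι i ≡ i
    ι-nonunit i = inv-nonunit i (unit? n ⟦ i ⟧)

    commute : ∀ x y → x *ᶻ y ≈ 1ℤ [ n ] → y *ᶻ x ≈ 1ℤ [ n ]
    commute x y p = ≈-trans (≈-reflexive (ℤ.*-comm y x)) p

    ι-involutive : ∀ i → ι (ι i) ≡ i
    ι-involutive i = helper (unit? n ⟦ i ⟧)
      where
      helper : Dec (Unit n ⟦ i ⟧) → ι (ι i) ≡ i
      helper (yes u) = ⟦⟧-injective (unit-cancelˡ ⟦ ι i ⟧ ιi-unit
        (≈-trans (ι-unit (ι i) ιi-unit) (≈-sym (commute ⟦ i ⟧ ⟦ ι i ⟧ (ι-unit i u)))))
        where
        ιi-unit : Unit n ⟦ ι i ⟧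
        ιi-unit = unit ⟦ i ⟧ (commute ⟦ i ⟧ ⟦ ι i ⟧ (ι-unit i u))
      helper (no ¬u) = trans (cong ι (ι-nonunit i ¬u)) (ι-nonunit i ¬u)

    unitSquare⇒unit : ∀ {x} → UnitSquare n x → Unit n x
    unitSquare⇒unit (a , u , p) = unit-resp (≈-sym p) (unit-* u u)

    inverse-unitSquare : ∀ {x} y → x *ᶻ y ≈ 1ℤ [ n ] → UnitSquare n x → UnitSquare n y
    inverse-unitSquare {x} y xy≈1 (a , u@(unit b ab≈1) , x≈a²) = b , unit a (commute a b ab≈1) ,
      unit-cancelˡ x (unit y xy≈1) (≈-trans xy≈1 (≈-sym (≈-trans (*-congʳ (b *ᶻ b) x≈a²)
        (≈-trans (≈-reflexive (eq a b)) (*-cong ab≈1 ab≈1)))))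
      where
      eq : ∀ a b → a *ᶻ a *ᶻ (b *ᶻ b) ≡ a *ᶻ b *ᶻ (a *ᶻ b)
      eq = solve-∀

    σ-ι : ∀ i → σ n ⟦ ι i ⟧ ≡ σ n ⟦ i ⟧
    σ-ι i = helper (unit? n ⟦ i ⟧)
      where
      helper : Dec (Unit n ⟦ i ⟧) → σ n ⟦ ι i ⟧ ≡ σ n ⟦ i ⟧
      helper (yes u) = 𝟙-cong (unitSquare? n ⟦ ι i ⟧) (unitSquare? n ⟦ i ⟧)
        (inverse-unitSquare ⟦ i ⟧ (commute ⟦ i ⟧ ⟦ ι i ⟧ (ι-unit i u))) (inverse-unitSquare ⟦ ι i ⟧ (ι-unit i u))
      helper (no ¬u) = cong (λ j → σ n ⟦ j ⟧) (ι-nonunit i ¬u)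

  -- Inversion permutes the unit squares, and 1 is its only fixed point among them.
  ∑σ-odd : (∀ x → x *ᶻ x ≈ 1ℤ [ n ] → x ≈ 1ℤ [ n ] ⊎ x ≈ -1ℤ [ n ]) → ¬ UnitSquare n -1ℤ →
           ∃ λ c → ∑mod n (σ n) ≡ 1 + 2 * c
  ∑σ-odd √1 ¬sq = c , (begin
    ∑mod n (σ n)                                              ≡⟨ ∑mod≡∑ (σ n) ⟩
    ∑[ i < n ] σ n ⟦ i ⟧                                      ≡⟨ parity ⟩
    ∑[ i < n ] (σ n ⟦ i ⟧ * 𝟙 (ι i ≟ᶠ i)) + 2 * c             ≡⟨ cong (_+ 2 * c) (sum-cong-≗ {n} fixed) ⟩
    ∑[ i < n ] 𝟙 (⟦ i ⟧ ≈? 1ℤ [ n ]) + 2 * c                  ≡⟨ cong (_+ 2 * c) (∑mod≡∑ (λ x → 𝟙 (x ≈? 1ℤ [ n ]))) ⟨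
    ∑mod n (λ x → 𝟙 (x ≈? 1ℤ [ n ])) + 2 * c                  ≡⟨ cong (_+ 2 * c) (∑mod-𝟙 n 1ℤ) ⟩
    1 + 2 * c                                                 ∎)
    where
    open ≡-Reasoning
    pair = involution-parity (λ i → σ n ⟦ i ⟧) ι ι-involutive σ-ι
    c = proj₁ pair
    parity = proj₂ pair
    to : ∀ i → UnitSquare n ⟦ i ⟧ × ι i ≡ i → ⟦ i ⟧ ≈ 1ℤ [ n ]
    -- A unit fixed by inversion satisfies x² = 1, hence is 1 or -1, and -1 is excluded because it
    -- is assumed not to be a unit square.
    to i (sq , ιi≡i) = [ id , (λ p → contradiction (unitSquare-resp n p sq) ¬sq) ]′
      (√1 ⟦ i ⟧ (subst (λ j → ⟦ i ⟧ *ᶻ ⟦ j ⟧ ≈ 1ℤ [ n ]) ιi≡i (ι-unit i (unitSquare⇒unit sq))))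
    from : ∀ i → ⟦ i ⟧ ≈ 1ℤ [ n ] → UnitSquare n ⟦ i ⟧ × ι i ≡ i
    from i p = unitSquare-resp n (≈-sym p) (1ℤ , unit-1 , ≈-refl) ,
      ⟦⟧-injective (unit-cancelˡ ⟦ i ⟧ u (≈-trans (ι-unit i u) (≈-sym (*-cong p p))))
      where
      u : Unit n ⟦ i ⟧
      u = unit-resp (≈-sym p) unit-1
    fixed : ∀ i → σ n ⟦ i ⟧ * 𝟙 (ι i ≟ᶠ i) ≡ 𝟙 (⟦ i ⟧ ≈? 1ℤ [ n ])
    fixed i = trans (sym (𝟙-× (unitSquare? n ⟦ i ⟧) (ι i ≟ᶠ i)))
      (𝟙-cong (unitSquare? n ⟦ i ⟧ ×-dec ι i ≟ᶠ i) (⟦ i ⟧ ≈? 1ℤ [ n ]) (to i) (from i))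

module PrimePower (p a : ℕ) (p-prime : Prime p) (p%4≡1 : p % 4 ≡ 1) where

  -- The exponent is written as a successor so that p^(α - 1) is `p ^ a`, without subtraction.
  N : ℕ
  N = p ^ suc a

  instance
    p≢0 : NonZero p
    p≢0 = prime⇒nonZero p-prime

    N≢0 : NonZero N
    N≢0 = ℕ.m^n≢0 p (suc a)

  private
    q : ℕ
    q = p ℕ./ 4

    p≡1+q*4 : p ≡ 1 + q * 4
    p≡1+q*4 = trans (m≡m%n+[m/n]*n p 4) (cong (_+ q * 4) p%4≡1)

  unit⇒≉0 : ∀ {x} → Unit p x → ¬ x ≈ 0ℤ [ p ]
  unit⇒≉0 {x} (unit b inv) x≈0 = contradiction (ℕ∣.∣1⇒≡1 (∣⇒∣ᵤ (congruent 1≈0))) (ℕ.nonTrivial⇒≢1 {{prime⇒nonTrivial p-prime}})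
    where
    1≈0 : 1ℤ ≈ 0ℤ [ p ]
    1≈0 = ≈-trans (≈-sym inv) (*-congʳ b x≈0)

  unit-or-zero : ∀ x → Unit p x ⊎ x ≈ 0ℤ [ p ]
  unit-or-zero x = helper (residue p x) (residue-≈ p x)
    where
    helper : ∀ (r : Fin p) → ⟦ r ⟧ ≈ x [ p ] → Unit p x ⊎ x ≈ 0ℤ [ p ]
    helper r r≈x with toℕ r | toℕ<n r
    ... | zero  | _   = inj₂ (≈-sym r≈x)
    ... | suc k | k<p = inj₁ (unit-resp r≈x (unit (proj₁ inverse) (proj₂ inverse)))
      where inverse = coprime⇒inverse (coprime-sym (prime⇒coprime p-prime k<p))

  unit-2 : Unit p (+ 2)
  -- With p = 1 + 4q one has 2 (-2q) = 1 - p.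
  unit-2 = unit (-ᶻ (+ 2 *ᶻ + q)) (≈-by (divides -1ℤ (begin
    + 2 *ᶻ -ᶻ (+ 2 *ᶻ + q) -ᶻ 1ℤ      ≡⟨ eq (+ q) ⟩
    -1ℤ *ᶻ (1ℤ +ᶻ + q *ᶻ + 4)         ≡⟨ cong (λ k → -1ℤ *ᶻ (1ℤ +ᶻ k)) (ℤ.pos-* q 4) ⟨
    -1ℤ *ᶻ + (1 + q * 4)              ≡⟨ cong (λ k → -1ℤ *ᶻ + k) p≡1+q*4 ⟨
    -1ℤ *ᶻ + p                        ∎)))
    where
    open ≡-Reasoning
    eq : ∀ q → + 2 *ᶻ -ᶻ (+ 2 *ᶻ q) -ᶻ 1ℤ ≡ -1ℤ *ᶻ (1ℤ +ᶻ q *ᶻ + 4)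
    eq = solve-∀

  ν : ℤ → ℕ
  ν x = 𝟙 (x ≈? 0ℤ [ p ])

  ν-periodic : Periodic p ν
  ν-periodic = 𝟙-≈-periodicˡ p 0ℤ

  υ+ν≡1 : ∀ x → υ p x + ν x ≡ 1
  υ+ν≡1 x = helper (unit-or-zero x)
    where
    helper : Unit p x ⊎ x ≈ 0ℤ [ p ] → υ p x + ν x ≡ 1
    helper (inj₁ u) = cong₂ _+_ (υ-unit p u) (𝟙-no (x ≈? 0ℤ [ p ]) (unit⇒≉0 u))
    helper (inj₂ z) = cong₂ _+_ (𝟙-no (unit? p x) (λ u → unit⇒≉0 u z)) (𝟙-yes (x ≈? 0ℤ [ p ]) z)

  ∑ν : ∀ c → ∑mod p (λ x → ν (x -ᶻ c)) ≡ 1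
  ∑ν c = trans (∑mod-translate p {ν} (-ᶻ c) ν-periodic) (∑mod-𝟙 p 0ℤ)

  φ+1≡p : φ p + 1 ≡ p
  φ+1≡p = begin
    φ p + 1                                        ≡⟨ cong (φ p ℕ.+_) (∑mod-𝟙 p 0ℤ) ⟨
    ∑mod p (υ p) + ∑mod p ν                        ≡⟨ ∑mod-+ p (υ p) ν ⟨
    ∑mod p (λ x → υ p x + ν x)                     ≡⟨ ∑mod-cong p υ+ν≡1 ⟩
    ∑mod p (λ _ → 1)                               ≡⟨ trans (∑mod-const p 1) (ℕ.*-identityʳ p) ⟩
    p                                              ∎
    where open ≡-Reasoning

  unit-^ : ∀ {x} → Unit p x → ∀ b → Unit (p ^ b) x
  unit-^ u zero    = unit 0ℤ everything-≈-mod-1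
  unit-^ u (suc b) = unit-product (p ^ b) p (unit-^ u b) u

  -- Being a unit modulo a power of `p` depends only on the residue modulo `p`. Counts built from
  -- `υ` modulo `N` are therefore `p ^ a` times those modulo `p`.
  υ-^ : ∀ x → υ N x ≡ υ p x
  υ-^ x = 𝟙-cong (unit? N x) (unit? p x) (proj₂ ∘ unit-factors (p ^ a) p) (λ u → unit-^ u (suc a))

  ∑mod-N : ∀ {f} → Periodic p f → ∑mod N f ≡ p ^ a * ∑mod p f
  ∑mod-N {f} pf = trans (cong (λ n → ∑mod n f) (ℕ.*-comm p (p ^ a))) (∑mod-multiple p (p ^ a) pf)

  φ-N : φ N ≡ p ^ a * φ p
  φ-N = trans (∑mod-cong N υ-^) (∑mod-N {υ p} (υ-periodic p))

  ∑α-N : ∑mod N (α N) ≡ p ^ a * ∑mod p (α p)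
  ∑α-N = trans
    (∑mod-cong N (λ x → cong₂ _*_ (υ-^ x) (cong₂ _*_ (υ-^ (x *ᶻ x -ᶻ 1ℤ)) (υ-^ (x *ᶻ x +ᶻ 1ℤ)))))
    (∑mod-N {α p} (Multiplicative.periodic α-multiplicative p))

  -- x - 1 and x + 1 differ by the unit 2, so they do not both vanish modulo `p`. One of them is a
  -- unit modulo `N` and can be cancelled from (x - 1)(x + 1) ≡ 0.
  √1-N : ∀ x → x *ᶻ x ≈ 1ℤ [ N ] → x ≈ 1ℤ [ N ] ⊎ x ≈ -1ℤ [ N ]
  √1-N x x²≈1 = helper (unit-or-zero (x -ᶻ 1ℤ))
    where
    eq₁ : ∀ x → (x -ᶻ 1ℤ) *ᶻ x -ᶻ (x -ᶻ 1ℤ) *ᶻ -1ℤ ≡ 1ℤ *ᶻ (x *ᶻ x -ᶻ 1ℤ)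
    eq₁ = solve-∀
    eq₂ : ∀ x → (x +ᶻ 1ℤ) *ᶻ x -ᶻ (x +ᶻ 1ℤ) *ᶻ 1ℤ ≡ 1ℤ *ᶻ (x *ᶻ x -ᶻ 1ℤ)
    eq₂ = solve-∀
    eq₃ : ∀ x → + 2 -ᶻ (x +ᶻ 1ℤ) ≡ -1ℤ *ᶻ (x -ᶻ 1ℤ -ᶻ 0ℤ)
    eq₃ = solve-∀
    helper : Unit p (x -ᶻ 1ℤ) ⊎ x -ᶻ 1ℤ ≈ 0ℤ [ p ] → x ≈ 1ℤ [ N ] ⊎ x ≈ -1ℤ [ N ]
    helper (inj₁ u) = inj₂ (unit-cancelˡ (x -ᶻ 1ℤ) (unit-^ u (suc a)) (≈-lin 1ℤ x²≈1 (eq₁ x)))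
    helper (inj₂ z) = inj₁ (unit-cancelˡ (x +ᶻ 1ℤ) (unit-^ (unit-resp (≈-lin -1ℤ z (eq₃ x)) unit-2) (suc a)) (≈-lin 1ℤ x²≈1 (eq₂ x)))

  #√1-N : #√1 N ≡ 2
  #√1-N = begin
    #√1 N                                                                          ≡⟨ ∑mod-cong N split ⟩
    ∑mod N (λ x → 𝟙 (x ≈? 1ℤ [ N ]) + 𝟙 (x ≈? -1ℤ [ N ]))                           ≡⟨ ∑mod-+ N (λ x → 𝟙 (x ≈? 1ℤ [ N ])) (λ x → 𝟙 (x ≈? -1ℤ [ N ])) ⟩
    ∑mod N (λ x → 𝟙 (x ≈? 1ℤ [ N ])) + ∑mod N (λ x → 𝟙 (x ≈? -1ℤ [ N ]))            ≡⟨ cong₂ _+_ (∑mod-𝟙 N 1ℤ) (∑mod-𝟙 N -1ℤ) ⟩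
    2                                                                              ∎
    where
    open ≡-Reasoning
    split : ∀ x → 𝟙 (x *ᶻ x ≈? 1ℤ [ N ]) ≡ 𝟙 (x ≈? 1ℤ [ N ]) + 𝟙 (x ≈? -1ℤ [ N ])
    split x = 𝟙-⊎ (x *ᶻ x ≈? 1ℤ [ N ]) (x ≈? 1ℤ [ N ]) (x ≈? -1ℤ [ N ])
      -- The two roots are distinct: if 1 and -1 agreed modulo `N`, then 2 would vanish modulo `p`.
      (λ (x≈1 , x≈-1) → unit⇒≉0 unit-2 (≈-factorˡ (p ^ a) p (≈-lin₂ 1ℤ -1ℤ x≈-1 x≈1 (eq x))))
      (√1-N x) [ (λ q → *-cong q q) , (λ q → *-cong q q) ]′
      where
      eq : ∀ x → + 2 -ᶻ 0ℤ ≡ 1ℤ *ᶻ (x -ᶻ -1ℤ) +ᶻ -1ℤ *ᶻ (x -ᶻ 1ℤ)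
      eq = solve-∀

  -1-unitSquare : UnitSquare N -1ℤ
  -1-unitSquare = decidable-stable (unitSquare? N -1ℤ) λ ¬sq →
    let c , ∑σ≡1+2c = ∑σ-odd N √1-N ¬sq in
    ℕ.even≢odd (p ^ a * q) c (trans (sym ∑σ-even) ∑σ≡1+2c)
    where
    open ≡-Reasoning
    φ-p : φ p ≡ q * 4
    φ-p = ℕ.+-cancelʳ-≡ 1 (φ p) (q * 4) (trans φ+1≡p (trans p≡1+q*4 (ℕ.+-comm 1 (q * 4))))
    double : ∀ x q → x * (q * 4) ≡ 2 * (x * q) * 2
    double = ℕ-solve-∀
    -- This is where p ≡ 1 modulo 4 matters for the parity: p - 1 = 4q stays even after halving.
    ∑σ-even : ∑mod N (σ N) ≡ 2 * (p ^ a * q)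
    ∑σ-even = ℕ.*-cancelʳ-≡ (∑mod N (σ N)) (2 * (p ^ a * q)) 2 (begin
      ∑mod N (σ N) * 2         ≡⟨ cong (∑mod N (σ N) *_) #√1-N ⟨
      ∑mod N (σ N) * #√1 N     ≡⟨ ∑σ*#√1≡φ N ⟩
      φ N                      ≡⟨ trans φ-N (cong (p ^ a *_) φ-p) ⟩
      p ^ a * (q * 4)          ≡⟨ double (p ^ a) q ⟩
      2 * (p ^ a * q) * 2      ∎)

  -- Existence of a root is restated as a nonvanishing count, the form that passes to products of
  -- prime powers.
  #√-1-N≢0 : ∑mod N (√𝟙 -1ℤ N) ≢ 0
  #√-1-N≢0 = let i , _ , -1≈i² = -1-unitSquare in ∑mod-𝟙-≢0 N (λ x → x *ᶻ x ≈? -1ℤ [ N ])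
    (λ x≈y → ≈-trans (≈-sym (*-cong x≈y x≈y))) {i} (≈-sym -1≈i²)

  -- The left-hand combination exhibits x and y as coprime, so at most one vanishes modulo p.
  ν-* : ∀ {x y} a b k → Unit p k → a *ᶻ x +ᶻ b *ᶻ y ≈ k [ p ] → ν (x *ᶻ y) ≡ ν x + ν y
  ν-* {x} {y} a b k unit-k p≈k = 𝟙-⊎ (x *ᶻ y ≈? 0ℤ [ p ]) (x ≈? 0ℤ [ p ]) (y ≈? 0ℤ [ p ])
    (λ (x≈0 , y≈0) → unit⇒≉0 unit-k (≈-trans (≈-sym p≈k) (≈-lin₂ a b x≈0 y≈0 (eq a b x y))))
    (λ xy≈0 → [ (λ u → inj₂ (unit-cancelˡ x u (≈-trans xy≈0 (≈-reflexive (sym (ℤ.*-zeroʳ x)))))) , inj₁ ]′ (unit-or-zero x))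
    [ (λ x≈0 → *-congʳ y x≈0) , (λ y≈0 → ≈-trans (*-congˡ x y≈0) (≈-reflexive (ℤ.*-zeroʳ x))) ]′
    where
    eq : ∀ a b x y → a *ᶻ x +ᶻ b *ᶻ y -ᶻ 0ℤ ≡ a *ᶻ (x -ᶻ 0ℤ) +ᶻ b *ᶻ (y -ᶻ 0ℤ)
    eq = solve-∀

  -- Modulo `p` an element is either a unit or zero, so the residues missed by `α` are the zeros of
  -- t (t⁴ - 1), namely 0, 1, -1, i and -i. Each accounts for exactly one residue.
  ∑α+5≡p : ∑mod p (α p) + 5 ≡ p
  ∑α+5≡p = begin
    ∑mod p (α p) + 5
      ≡⟨ cong (∑mod p (α p) ℕ.+_) (cong₂ _+_ (∑ν 0ℤ) (cong₂ _+_ (cong₂ _+_ (∑ν 1ℤ) (∑ν -1ℤ)) (cong₂ _+_ (∑ν i) (∑ν (-ᶻ i))))) ⟨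
    ∑mod p (α p) + (∑ν′ 0ℤ + (∑ν′ 1ℤ + ∑ν′ -1ℤ + (∑ν′ i + ∑ν′ (-ᶻ i))))
      ≡⟨ cong (∑mod p (α p) ℕ.+_) ∑-roots ⟨
    ∑mod p (α p) + ∑mod p roots
      ≡⟨ ∑mod-+ p (α p) roots ⟨
    ∑mod p (λ t → α p t + roots t)
      ≡⟨ ∑mod-cong p (λ t → trans (cong₂ _+_ (α≡υ t) (sym (factorise t))) (υ+ν≡1 (z t))) ⟩
    ∑mod p (λ _ → 1)
      ≡⟨ trans (∑mod-const p 1) (ℕ.*-identityʳ p) ⟩
    p
      ∎
    where
    open ≡-Reasoning
    i : ℤ
    i = proj₁ -1-unitSquare
    unit-i : Unit p i
    unit-i = proj₂ (unit-factors (p ^ a) p (proj₁ (proj₂ -1-unitSquare)))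
    -1≈i² : -1ℤ ≈ i *ᶻ i [ p ]
    -1≈i² = ≈-factorˡ (p ^ a) p (proj₂ (proj₂ -1-unitSquare))

    ∑ν′ : ℤ → ℕ
    ∑ν′ c = ∑mod p (λ t → ν (t -ᶻ c))

    roots : ℤ → ℕ
    roots t = ν (t -ᶻ 0ℤ) + (ν (t -ᶻ 1ℤ) + ν (t -ᶻ -1ℤ) + (ν (t -ᶻ i) + ν (t -ᶻ -ᶻ i)))

    ∑-roots : ∑mod p roots ≡ ∑ν′ 0ℤ + (∑ν′ 1ℤ + ∑ν′ -1ℤ + (∑ν′ i + ∑ν′ (-ᶻ i)))
    ∑-roots = trans (∑mod-+ p (λ t → ν (t -ᶻ 0ℤ)) _) (cong (∑ν′ 0ℤ ℕ.+_)
      (trans (∑mod-+ p (λ t → ν (t -ᶻ 1ℤ) + ν (t -ᶻ -1ℤ)) (λ t → ν (t -ᶻ i) + ν (t -ᶻ -ᶻ i)))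
        (cong₂ _+_ (∑mod-+ p (λ t → ν (t -ᶻ 1ℤ)) (λ t → ν (t -ᶻ -1ℤ)))
                   (∑mod-+ p (λ t → ν (t -ᶻ i)) (λ t → ν (t -ᶻ -ᶻ i))))))

    z : ℤ → ℤ
    z t = t *ᶻ ((t *ᶻ t -ᶻ 1ℤ) *ᶻ (t *ᶻ t +ᶻ 1ℤ))

    α≡υ : ∀ t → α p t ≡ υ p (z t)
    α≡υ t = sym (trans (υ-* p t ((t *ᶻ t -ᶻ 1ℤ) *ᶻ (t *ᶻ t +ᶻ 1ℤ))) (cong (υ p t *_) (υ-* p (t *ᶻ t -ᶻ 1ℤ) (t *ᶻ t +ᶻ 1ℤ))))

    factorise : ∀ t → ν (z t) ≡ roots t
    factorise t = begin
      ν (z t)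
        -- No two factors vanish together, by the identities t³ t - (t⁴ - 1) = 1, (t² + 1) - (t² -
        -- 1) = 2 and (t + c) - (t - c) = 2c for c = 1 and c = i. The right-hand sides are units
        -- modulo `p`.
        ≡⟨ ν-* {t} {(t *ᶻ t -ᶻ 1ℤ) *ᶻ (t *ᶻ t +ᶻ 1ℤ)} (t *ᶻ t *ᶻ t) -1ℤ 1ℤ unit-1 (≈-reflexive (bezout₁ t)) ⟩
      ν t + ν ((t *ᶻ t -ᶻ 1ℤ) *ᶻ (t *ᶻ t +ᶻ 1ℤ))
        ≡⟨ cong (ν t ℕ.+_) (ν-* {t *ᶻ t -ᶻ 1ℤ} {t *ᶻ t +ᶻ 1ℤ} -1ℤ 1ℤ (+ 2) unit-2 (≈-reflexive (bezout₂ t))) ⟩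
      ν t + (ν (t *ᶻ t -ᶻ 1ℤ) + ν (t *ᶻ t +ᶻ 1ℤ))
        -- t² - 1 splits over ℤ, whereas t² + 1 = (t - i)(t + i) holds only modulo `p`, where -1 ≡
        -- i².
        ≡⟨ cong₂ _+_ (cong ν (ℤ.+-identityʳ t)) (cong₂ _+_ (cong ν (product₁ t)) (ν-periodic (≈-lin 1ℤ -1≈i² (product₂ t i)))) ⟨
      ν (t -ᶻ 0ℤ) + (ν ((t -ᶻ 1ℤ) *ᶻ (t -ᶻ -1ℤ)) + ν ((t -ᶻ i) *ᶻ (t -ᶻ -ᶻ i)))
        ≡⟨ cong (ν (t -ᶻ 0ℤ) ℕ.+_) (cong₂ _+_
             (ν-* {t -ᶻ 1ℤ} {t -ᶻ -1ℤ} -1ℤ 1ℤ (+ 2) unit-2 (≈-reflexive (bezout₃ t 1ℤ)))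
             (ν-* {t -ᶻ i} {t -ᶻ -ᶻ i} -1ℤ 1ℤ (+ 2 *ᶻ i) (unit-* unit-2 unit-i) (≈-reflexive (bezout₃ t i)))) ⟩
      roots t
        ∎
      where
      bezout₁ : ∀ t → t *ᶻ t *ᶻ t *ᶻ t +ᶻ -1ℤ *ᶻ ((t *ᶻ t -ᶻ 1ℤ) *ᶻ (t *ᶻ t +ᶻ 1ℤ)) ≡ 1ℤ
      bezout₁ = solve-∀
      bezout₂ : ∀ t → -1ℤ *ᶻ (t *ᶻ t -ᶻ 1ℤ) +ᶻ 1ℤ *ᶻ (t *ᶻ t +ᶻ 1ℤ) ≡ + 2
      bezout₂ = solve-∀
      bezout₃ : ∀ t i → -1ℤ *ᶻ (t -ᶻ i) +ᶻ 1ℤ *ᶻ (t -ᶻ -ᶻ i) ≡ + 2 *ᶻ i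
      bezout₃ = solve-∀
      product₁ : ∀ t → (t -ᶻ 1ℤ) *ᶻ (t -ᶻ -1ℤ) ≡ t *ᶻ t -ᶻ 1ℤ
      product₁ = solve-∀
      product₂ : ∀ t i → (t -ᶻ i) *ᶻ (t -ᶻ -ᶻ i) -ᶻ (t *ᶻ t +ᶻ 1ℤ) ≡ 1ℤ *ᶻ (-1ℤ -ᶻ i *ᶻ i)
      product₂ = solve-∀

-- Cliques

count : ∀ {ℓ} {n} {Q : Subset n → Set ℓ} → (∀ s → Dec (Q s)) → ℕ
count {n = n} Q? = length (filter Q? (subsets n))

count-cong : ∀ {ℓ ℓ′} {n} {Q : Subset n → Set ℓ} {R : Subset n → Set ℓ′} (Q? : ∀ s → Dec (Q s)) (R? : ∀ s → Dec (R s)) →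
             (∀ {s} → Q s → R s) → (∀ {s} → R s → Q s) → count Q? ≡ count R?
count-cong {n = n} Q? R? to from = cong length (filter-≐ Q? R? (to , from) (subsets n))

count-none : ∀ {ℓ} {n} {Q : Subset n → Set ℓ} (Q? : ∀ s → Dec (Q s)) → (∀ {s} → ¬ Q s) → count Q? ≡ 0
count-none {n = n} Q? ¬Q = cong length (filter-none Q? {subsets n} (All.tabulate (λ _ → ¬Q)))

length-filter-map : ∀ {A B : Set} {ℓ} {Q : B → Set ℓ} (Q? : ∀ y → Dec (Q y)) (f : A → B) xs →
                    length (filter Q? (map f xs)) ≡ length (filter (Q? ∘ f) xs)
length-filter-map Q? f []       = refl
length-filter-map Q? f (x ∷ xs) with does (Q? (f x))
... | true  = cong suc (length-filter-map Q? f xs)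
... | false = length-filter-map Q? f xs

count-suc : ∀ {ℓ} {n} {Q : Subset (suc n) → Set ℓ} (Q? : ∀ s → Dec (Q s)) →
            count Q? ≡ count (λ s → Q? (outside ∷ s)) + count (λ s → Q? (inside ∷ s))
count-suc {n = n} Q? = begin
  length (filter Q? (map (outside ∷_) S ++ map (inside ∷_) S))
    ≡⟨ cong length (filter-++ Q? (map (outside ∷_) S) (map (inside ∷_) S)) ⟩
  length (filter Q? (map (outside ∷_) S) ++ filter Q? (map (inside ∷_) S))
    ≡⟨ length-++ (filter Q? (map (outside ∷_) S)) ⟩
  length (filter Q? (map (outside ∷_) S)) + length (filter Q? (map (inside ∷_) S))
    ≡⟨ cong₂ _+_ (length-filter-map Q? (outside ∷_) S) (length-filter-map Q? (inside ∷_) S) ⟩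
  count (λ s → Q? (outside ∷ s)) + count (λ s → Q? (inside ∷ s))
    ∎
  where
  open ≡-Reasoning
  S = subsets n

count-×ˡ : ∀ {ℓ ℓ′} {n} {P : Set ℓ} {Q : Subset n → Set ℓ′} (P? : Dec P) (Q? : ∀ s → Dec (Q s)) →
           count (λ s → P? ×-dec Q? s) ≡ 𝟙 P? * count Q?
count-×ˡ P?@(yes p) Q? = trans (count-cong (λ s → P? ×-dec Q? s) Q? proj₂ (p ,_))
  (trans (sym (ℕ.*-identityˡ (count Q?))) (cong (_* count Q?) (sym (𝟙-yes P? p))))
count-×ˡ P?@(no ¬p) Q? = trans (count-none (λ s → P? ×-dec Q? s) (¬p ∘ proj₁)) (cong (_* count Q?) (sym (𝟙-no P? ¬p)))

-- Cliques of order m all of whose vertices satisfy P; the predicate P is what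
-- makes a recursion on the number of vertices possible.
record CliqueIn {n} (E : Rel (Fin n) 0ℓ) (P : Fin n → Set) (m : ℕ) (s : Subset n) : Set where
  constructor cliqueIn
  field
    order  : ∣ s ∣ˢ ≡ m
    clique : IsClique E s
    within : ∀ x → x ∈ s → P x

open CliqueIn

cliqueIn? : ∀ {n} {E : Rel (Fin n) 0ℓ} {P : Fin n → Set} → Decidable E → (∀ x → Dec (P x)) → ∀ m s → Dec (CliqueIn E P m s)
cliqueIn? E? P? m s = map′ (λ (o , c , w) → cliqueIn o c w) (λ (cliqueIn o c w) → o , c , w)
  ((∣ s ∣ˢ ℕ.≟ m) ×-dec isClique? E? s ×-dec all? (λ x → (x ∈? s) →-dec P? x))

#cliques : ∀ {n} {E : Rel (Fin n) 0ℓ} {P : Fin n → Set} → Decidable E → (∀ x → Dec (P x)) → ℕ → ℕ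
#cliques E? P? m = count (cliqueIn? E? P? m)

module _ {n} {E : Rel (Fin (suc n)) 0ℓ} {P : Fin (suc n) → Set} where

  private
    E⁺ : Rel (Fin n) 0ℓ
    E⁺ x y = E (suc x) (suc y)

    ∈-suc : ∀ {b x} {s : Subset n} → suc x ∈ (b ∷ s) → x ∈ s
    ∈-suc (there x∈s) = x∈s

  outside-clique : ∀ {m s} → CliqueIn E P m (outside ∷ s) → CliqueIn E⁺ (P ∘ suc) m s
  outside-clique c = cliqueIn (order c)
    (λ x y x∈s y∈s x≢y → clique c (suc x) (suc y) (there x∈s) (there y∈s) (x≢y ∘ suc-injective))
    (λ x x∈s → within c (suc x) (there x∈s))

  clique-outside : ∀ {m s} → CliqueIn E⁺ (P ∘ suc) m s → CliqueIn E P m (outside ∷ s)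
  clique-outside c = cliqueIn (order c)
    (λ { (suc x) (suc y) x∈ y∈ x≢y → clique c x y (∈-suc x∈) (∈-suc y∈) (x≢y ∘ cong suc) })
    (λ { (suc x) x∈ → within c x (∈-suc x∈) })

  inside-clique : ∀ {m s} → CliqueIn E P (suc m) (inside ∷ s) →
                  P zero × CliqueIn E⁺ (λ x → P (suc x) × E zero (suc x)) m s
  inside-clique c = within c zero here , cliqueIn (ℕ.suc-injective (order c))
    (λ x y x∈s y∈s x≢y → clique c (suc x) (suc y) (there x∈s) (there y∈s) (x≢y ∘ suc-injective))
    (λ x x∈s → within c (suc x) (there x∈s) , clique c zero (suc x) here (there x∈s) (λ ()))

  clique-inside : Symmetric E → ∀ {m s} → P zero × CliqueIn E⁺ (λ x → P (suc x) × E zero (suc x)) m s →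
                  CliqueIn E P (suc m) (inside ∷ s)
  clique-inside E-sym (p , c) = cliqueIn (cong suc (order c))
    (λ { zero    zero    x∈ y∈ x≢y → contradiction refl x≢y
       ; zero    (suc y) x∈ y∈ x≢y → proj₂ (within c y (∈-suc y∈))
       ; (suc x) zero    x∈ y∈ x≢y → E-sym (proj₂ (within c x (∈-suc x∈)))
       ; (suc x) (suc y) x∈ y∈ x≢y → clique c x y (∈-suc x∈) (∈-suc y∈) (x≢y ∘ cong suc) })
    (λ { zero x∈ → p ; (suc x) x∈ → proj₁ (within c x (∈-suc x∈)) })

  module _ (E? : Decidable E) (P? : ∀ x → Dec (P x)) where

    private
      E⁺? : Decidable E⁺
      E⁺? x y = E? (suc x) (suc y)

    #cliques-zero : #cliques E? P? 0 ≡ #cliques E⁺? (λ x → P? (suc x)) 0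
    #cliques-zero = trans (count-suc (cliqueIn? E? P? 0)) (trans (cong₂ _+_
      (count-cong (λ s → cliqueIn? E? P? 0 (outside ∷ s)) (cliqueIn? E⁺? (λ x → P? (suc x)) 0) outside-clique clique-outside)
      (count-none (λ s → cliqueIn? E? P? 0 (inside ∷ s)) (λ c → ℕ.1+n≢0 (order c))))
      (ℕ.+-identityʳ _))

    -- A clique either avoids vertex `zero`, or consists of `zero` and a smaller clique among its
    -- neighbours. Adjacency to `zero` is absorbed into the vertex predicate.
    #cliques-suc : Symmetric E → ∀ m → #cliques E? P? (suc m) ≡
      #cliques E⁺? (λ x → P? (suc x)) (suc m) + 𝟙 (P? zero) * #cliques E⁺? (λ x → P? (suc x) ×-dec E? zero (suc x)) m
    #cliques-suc E-sym m = trans (count-suc (cliqueIn? E? P? (suc m))) (cong₂ _+_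
      (count-cong (λ s → cliqueIn? E? P? (suc m) (outside ∷ s)) (cliqueIn? E⁺? (λ x → P? (suc x)) (suc m)) outside-clique clique-outside)
      (trans
        (count-cong (λ s → cliqueIn? E? P? (suc m) (inside ∷ s)) (λ s → P? zero ×-dec neighbours? s) inside-clique (clique-inside E-sym))
        (count-×ˡ (P? zero) neighbours?)))
      where
      neighbours? = cliqueIn? E⁺? (λ x → P? (suc x) ×-dec E? zero (suc x)) m

#cliques-0 : ∀ {n} {E : Rel (Fin n) 0ℓ} {P : Fin n → Set} (E? : Decidable E) (P? : ∀ x → Dec (P x)) → #cliques E? P? 0 ≡ 1
#cliques-0 {zero} {E} {P} E? P? = trans
  (count-cong (cliqueIn? E? P? 0) (λ _ → yes tt) (λ _ → tt) (λ { {[]} _ → cliqueIn refl (λ ()) (λ ()) })) refl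
#cliques-0 {suc n} E? P? = trans (#cliques-zero E? P?) (#cliques-0 (λ x y → E? (suc x) (suc y)) (λ x → P? (suc x)))

#cliques-[] : ∀ {E : Rel (Fin 0) 0ℓ} {P : Fin 0 → Set} (E? : Decidable E) (P? : ∀ x → Dec (P x)) m → #cliques E? P? (suc m) ≡ 0
#cliques-[] E? P? m = count-none (cliqueIn? E? P? (suc m)) (λ { {[]} c → ℕ.0≢1+n (order c) })

#cliques-1 : ∀ {n} {E : Rel (Fin n) 0ℓ} {P : Fin n → Set} (E? : Decidable E) (P? : ∀ x → Dec (P x)) → Symmetric E →
             #cliques E? P? 1 ≡ ∑[ x < n ] 𝟙 (P? x)
#cliques-1 {zero}  E? P? E-sym = #cliques-[] E? P? 0
#cliques-1 {suc n} {E} {P} E? P? E-sym = begin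
  #cliques E? P? 1
    ≡⟨ #cliques-suc E? P? E-sym 0 ⟩
  #cliques E⁺? P⁺? 1 + 𝟙 (P? zero) * #cliques E⁺? N? 0
    ≡⟨ cong₂ _+_ (#cliques-1 E⁺? P⁺? E-sym) (trans (cong (𝟙 (P? zero) *_) (#cliques-0 E⁺? N?)) (ℕ.*-identityʳ (𝟙 (P? zero)))) ⟩
  ∑[ x < n ] 𝟙 (P⁺? x) + 𝟙 (P? zero)
    ≡⟨ ℕ.+-comm (∑[ x < n ] 𝟙 (P⁺? x)) (𝟙 (P? zero)) ⟩
  ∑[ x < suc n ] 𝟙 (P? x)
    ∎
  where
  open ≡-Reasoning
  E⁺? = λ x y → E? (suc x) (suc y)
  P⁺? = λ x → P? (suc x)
  N?  = λ x → P? (suc x) ×-dec E? zero (suc x)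

-- Weighted sums over ordered edges and triangles

edges : ∀ n → (Fin n → ℕ) → (Fin n → Fin n → ℕ) → ℕ
edges n w e = ∑[ x < n ] ∑[ y < n ] (w x * (w y * e x y))

-- The weights mirror the vertex predicate of `CliqueIn`: multiplying `w` by the adjacency to vertex
-- `zero` restricts the sum to its neighbours, which matches the recursion for `#cliques`.
triangles : ∀ n → (Fin n → ℕ) → (Fin n → Fin n → ℕ) → ℕ
triangles n w e = ∑[ x < n ] ∑[ y < n ] ∑[ z < n ] (w x * (w y * (w z * (e x y * (e y z * e x z)))))

sum≡0⇐ : ∀ {n} {f : Fin n → ℕ} → (∀ i → f i ≡ 0) → sum f ≡ 0
sum≡0⇐ {n} eq = trans (sum-cong-≗ {n} eq) (sum-replicate-zero n)

module _ {n} (w : Fin (suc n) → ℕ) (e : Fin (suc n) → Fin (suc n) → ℕ)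
         (e-sym : ∀ x y → e x y ≡ e y x) (e-irrefl : ∀ x → e x x ≡ 0) where

  private
    w⁺ w₀ : Fin n → ℕ
    w⁺ x = w (suc x)
    w₀ x = w (suc x) * e zero (suc x)

    e⁺ : Fin n → Fin n → ℕ
    e⁺ x y = e (suc x) (suc y)

  -- Vertex `zero` can stand in either place of an ordered edge, and by symmetry both places
  -- contribute equally. It cannot stand in both, since `e` vanishes on the diagonal.
  edges-suc : edges (suc n) w e ≡ edges n w⁺ e⁺ + 2 * (w zero * sum w₀)
  edges-suc = begin
    f zero zero + ∑[ y < n ] f zero (suc y) + ∑[ x < n ] (f (suc x) zero + ∑[ y < n ] f (suc x) (suc y))
      ≡⟨ cong₂ _+_ (cong₂ _+_ corner row) (∑-distrib-+ {n} (λ x → f (suc x) zero) _) ⟩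
    w zero * sum w₀ + (∑[ x < n ] f (suc x) zero + edges n w⁺ e⁺)
      ≡⟨ cong (λ s → w zero * sum w₀ + (s + edges n w⁺ e⁺)) column ⟩
    w zero * sum w₀ + (w zero * sum w₀ + edges n w⁺ e⁺)
      ≡⟨ collect (w zero * sum w₀) (edges n w⁺ e⁺) ⟩
    edges n w⁺ e⁺ + 2 * (w zero * sum w₀)
      ∎
    where
    open ≡-Reasoning
    f : Fin (suc n) → Fin (suc n) → ℕ
    f x y = w x * (w y * e x y)
    collect : ∀ a b → a + (a + b) ≡ b + 2 * a
    collect = ℕ-solve-∀
    corner : f zero zero ≡ 0
    corner = trans (cong (λ k → w zero * (w zero * k)) (e-irrefl zero)) (vanish (w zero))
      where
      vanish : ∀ a → a * (a * 0) ≡ 0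
      vanish = ℕ-solve-∀
    row : ∑[ y < n ] f zero (suc y) ≡ w zero * sum w₀
    row = sym (*-distribˡ-sum {n} (w zero) w₀)
    column : ∑[ x < n ] f (suc x) zero ≡ w zero * sum w₀
    column = trans
      (sum-cong-≗ {n} (λ x → trans (cong (λ k → w (suc x) * (w zero * k)) (e-sym (suc x) zero)) (swap (w (suc x)) (w zero) (e zero (suc x)))))
      row
      where
      swap : ∀ a b c → a * (b * c) ≡ b * (a * c)
      swap = ℕ-solve-∀

  -- Triples with a repeated vertex contribute nothing, so vertex `zero` occurs at most once. Its
  -- three possible positions each give the weighted edge sum over its neighbours.
  triangles-suc : triangles (suc n) w e ≡ triangles n w⁺ e⁺ + 3 * (w zero * edges n w₀ e⁺)
  triangles-suc = begin
    f zero zero zero + ∑[ z < n ] f zero zero (suc z) + ∑[ y < n ] (f zero (suc y) zero + ∑[ z < n ] f zero (suc y) (suc z))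
      + ∑[ x < n ] (f (suc x) zero zero + ∑[ z < n ] f (suc x) zero (suc z) + ∑[ y < n ] (f (suc x) (suc y) zero + ∑[ z < n ] f (suc x) (suc y) (suc z)))
      ≡⟨ cong₂ _+_ (cong₂ _+_ (cong₂ _+_ (f₁ zero zero) (sum≡0⇐ (λ z → f₁ zero (suc z)))) (sum-cong-≗ {n} (λ y → cong (_+ ∑[ z < n ] f zero (suc y) (suc z)) (f₂ zero (suc y)))))
           (sum-cong-≗ {n} (λ x → cong₂ _+_ (cong (_+ ∑[ z < n ] f (suc x) zero (suc z)) (f₃ zero (suc x))) (∑-distrib-+ {n} (λ y → f (suc x) (suc y) zero) _))) ⟩
    ∑[ y < n ] ∑[ z < n ] f zero (suc y) (suc z)
      + ∑[ x < n ] (∑[ z < n ] f (suc x) zero (suc z) + (∑[ y < n ] f (suc x) (suc y) zero + ∑[ y < n ] ∑[ z < n ] f (suc x) (suc y) (suc z)))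
      ≡⟨ cong (∑[ y < n ] ∑[ z < n ] f zero (suc y) (suc z) ℕ.+_) (trans (∑-distrib-+ {n} (λ x → ∑[ z < n ] f (suc x) zero (suc z)) _)
           (cong (∑[ x < n ] ∑[ z < n ] f (suc x) zero (suc z) ℕ.+_) (∑-distrib-+ {n} (λ x → ∑[ y < n ] f (suc x) (suc y) zero) _))) ⟩
    ∑[ y < n ] ∑[ z < n ] f zero (suc y) (suc z)
      + (∑[ x < n ] ∑[ z < n ] f (suc x) zero (suc z) + (∑[ x < n ] ∑[ y < n ] f (suc x) (suc y) zero + triangles n w⁺ e⁺))
      -- By symmetry of `e` all edges at `zero` can be written as leaving `zero`; the three faces
      -- then coincide.
      ≡⟨ cong₂ _+_ (face (λ y z → f zero (suc y) (suc z)) face₁) (cong₂ _+_ (face (λ x z → f (suc x) zero (suc z)) face₂)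
           (cong (_+ triangles n w⁺ e⁺) (face (λ x y → f (suc x) (suc y) zero) face₃))) ⟩
    F + (F + (F + triangles n w⁺ e⁺))
      ≡⟨ collect F (triangles n w⁺ e⁺) ⟩
    triangles n w⁺ e⁺ + 3 * F
      ∎
    where
    open ≡-Reasoning
    f : Fin (suc n) → Fin (suc n) → Fin (suc n) → ℕ
    f x y z = w x * (w y * (w z * (e x y * (e y z * e x z))))
    F : ℕ
    F = w zero * edges n w₀ e⁺
    collect : ∀ a b → a + (a + (a + b)) ≡ b + 3 * a
    collect = ℕ-solve-∀

    f₁ : ∀ x z → f x x z ≡ 0
    f₁ x z = trans (cong (λ k → w x * (w x * (w z * (k * (e x z * e x z))))) (e-irrefl x)) (vanish (w x) (w z))
      where
      vanish : ∀ a b → a * (a * (b * 0)) ≡ 0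
      vanish = ℕ-solve-∀
    f₂ : ∀ x y → f x y x ≡ 0
    f₂ x y = trans (cong (λ k → w x * (w y * (w x * (e x y * (e y x * k))))) (e-irrefl x)) (vanish (w x) (w y) (e x y) (e y x))
      where
      vanish : ∀ a b c d → a * (b * (a * (c * (d * 0)))) ≡ 0
      vanish = ℕ-solve-∀
    f₃ : ∀ y x → f x y y ≡ 0
    f₃ y x = trans (cong (λ k → w x * (w y * (w y * (e x y * (k * e x y))))) (e-irrefl y)) (vanish (w x) (w y) (e x y))
      where
      vanish : ∀ a b c → a * (b * (b * (c * 0))) ≡ 0
      vanish = ℕ-solve-∀

    face : ∀ (g : Fin n → Fin n → ℕ) → (∀ x y → g x y ≡ w zero * (w₀ x * (w₀ y * e⁺ x y))) → ∑[ x < n ] ∑[ y < n ] g x y ≡ F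
    face g eq = trans (sum-cong-≗ {n} (λ x → trans (sum-cong-≗ {n} (eq x)) (sym (*-distribˡ-sum {n} (w zero) _))))
      (sym (*-distribˡ-sum {n} (w zero) _))

    face₁ : ∀ y z → f zero (suc y) (suc z) ≡ w zero * (w₀ y * (w₀ z * e⁺ y z))
    face₁ y z = rearrange (w zero) (w (suc y)) (w (suc z)) (e zero (suc y)) (e (suc y) (suc z)) (e zero (suc z))
      where
      rearrange : ∀ a b c d e f → a * (b * (c * (d * (e * f)))) ≡ a * (b * d * (c * f * e))
      rearrange = ℕ-solve-∀
    face₂ : ∀ x z → f (suc x) zero (suc z) ≡ w zero * (w₀ x * (w₀ z * e⁺ x z))
    face₂ x z = trans (cong (λ k → w (suc x) * (w zero * (w (suc z) * (k * (e zero (suc z) * e (suc x) (suc z)))))) (e-sym (suc x) zero))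
      (rearrange (w (suc x)) (w zero) (w (suc z)) (e zero (suc x)) (e zero (suc z)) (e (suc x) (suc z)))
      where
      rearrange : ∀ a b c d e f → a * (b * (c * (d * (e * f)))) ≡ b * (a * d * (c * e * f))
      rearrange = ℕ-solve-∀
    face₃ : ∀ x y → f (suc x) (suc y) zero ≡ w zero * (w₀ x * (w₀ y * e⁺ x y))
    face₃ x y = trans (cong₂ (λ k l → w (suc x) * (w (suc y) * (w zero * (e (suc x) (suc y) * (k * l))))) (e-sym (suc y) zero) (e-sym (suc x) zero))
      (rearrange (w (suc x)) (w (suc y)) (w zero) (e (suc x) (suc y)) (e zero (suc y)) (e zero (suc x)))
      where
      rearrange : ∀ a b c d e f → a * (b * (c * (d * (e * f)))) ≡ c * (a * f * (b * e * d))
      rearrange = ℕ-solve-∀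

edges-cong : ∀ {n} {v w : Fin n → ℕ} e → (∀ x → v x ≡ w x) → edges n v e ≡ edges n w e
edges-cong {n} e eq = sum-cong-≗ {n} (λ x → sum-cong-≗ {n} (λ y → cong₂ _*_ (eq x) (cong (_* e x y) (eq y))))

2*#cliques-2 : ∀ {n} {E : Rel (Fin n) 0ℓ} {P : Fin n → Set} (E? : Decidable E) (P? : ∀ x → Dec (P x)) →
  Symmetric E → (∀ x → ¬ E x x) → 2 * #cliques E? P? 2 ≡ edges n (λ x → 𝟙 (P? x)) (λ x y → 𝟙 (E? x y))
2*#cliques-2 {zero}  E? P? E-sym E-irrefl = cong (2 *_) (#cliques-[] E? P? 1)
2*#cliques-2 {suc n} {E} {P} E? P? E-sym E-irrefl = begin
  2 * #cliques E? P? 2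
    ≡⟨ cong (2 *_) (#cliques-suc E? P? E-sym 1) ⟩
  2 * (#cliques E⁺? P⁺? 2 + 𝟙 (P? zero) * #cliques E⁺? N? 1)
    ≡⟨ ℕ.*-distribˡ-+ 2 (#cliques E⁺? P⁺? 2) _ ⟩
  2 * #cliques E⁺? P⁺? 2 + 2 * (𝟙 (P? zero) * #cliques E⁺? N? 1)
    ≡⟨ cong₂ _+_ (2*#cliques-2 E⁺? P⁺? E-sym (E-irrefl ∘ suc)) (cong (λ k → 2 * (𝟙 (P? zero) * k))
         (trans (#cliques-1 E⁺? N? E-sym) (sum-cong-≗ {n} (λ x → 𝟙-× (P? (suc x)) (E? zero (suc x)))))) ⟩
  edges n (λ x → 𝟙 (P⁺? x)) (λ x y → 𝟙 (E⁺? x y)) + 2 * (𝟙 (P? zero) * ∑[ x < n ] (𝟙 (P? (suc x)) * 𝟙 (E? zero (suc x))))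
    ≡⟨ edges-suc (λ x → 𝟙 (P? x)) (λ x y → 𝟙 (E? x y)) (λ x y → 𝟙-cong (E? x y) (E? y x) E-sym E-sym) (λ x → 𝟙-no (E? x x) (E-irrefl x)) ⟨
  edges (suc n) (λ x → 𝟙 (P? x)) (λ x y → 𝟙 (E? x y))
    ∎
  where
  open ≡-Reasoning
  E⁺? = λ x y → E? (suc x) (suc y)
  P⁺? = λ x → P? (suc x)
  N?  = λ x → P? (suc x) ×-dec E? zero (suc x)

-- Induction on the number of vertices: 6 splits as 3 · 2, with 3 positions for vertex `zero` and 2
-- orders of the edge formed by the other two vertices.
6*#cliques-3 : ∀ {n} {E : Rel (Fin n) 0ℓ} {P : Fin n → Set} (E? : Decidable E) (P? : ∀ x → Dec (P x)) →
  Symmetric E → (∀ x → ¬ E x x) → 6 * #cliques E? P? 3 ≡ triangles n (λ x → 𝟙 (P? x)) (λ x y → 𝟙 (E? x y))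
6*#cliques-3 {zero}  E? P? E-sym E-irrefl = cong (6 *_) (#cliques-[] E? P? 2)
6*#cliques-3 {suc n} {E} {P} E? P? E-sym E-irrefl = begin
  6 * #cliques E? P? 3
    ≡⟨ cong (6 *_) (#cliques-suc E? P? E-sym 2) ⟩
  6 * (#cliques E⁺? P⁺? 3 + 𝟙 (P? zero) * #cliques E⁺? N? 2)
    ≡⟨ distribute (#cliques E⁺? P⁺? 3) (𝟙 (P? zero)) (#cliques E⁺? N? 2) ⟩
  6 * #cliques E⁺? P⁺? 3 + 3 * (𝟙 (P? zero) * (2 * #cliques E⁺? N? 2))
    ≡⟨ cong₂ _+_ (6*#cliques-3 E⁺? P⁺? E-sym (E-irrefl ∘ suc)) (cong (λ k → 3 * (𝟙 (P? zero) * k))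
         (trans (2*#cliques-2 E⁺? N? E-sym (E-irrefl ∘ suc)) (edges-cong _ (λ x → 𝟙-× (P? (suc x)) (E? zero (suc x)))))) ⟩
  triangles n (λ x → 𝟙 (P⁺? x)) (λ x y → 𝟙 (E⁺? x y)) + 3 * (𝟙 (P? zero) * edges n (λ x → 𝟙 (P? (suc x)) * 𝟙 (E? zero (suc x))) (λ x y → 𝟙 (E⁺? x y)))
    ≡⟨ triangles-suc (λ x → 𝟙 (P? x)) (λ x y → 𝟙 (E? x y)) (λ x y → 𝟙-cong (E? x y) (E? y x) E-sym E-sym) (λ x → 𝟙-no (E? x x) (E-irrefl x)) ⟨
  triangles (suc n) (λ x → 𝟙 (P? x)) (λ x y → 𝟙 (E? x y))
    ∎
  where
  open ≡-Reasoning
  E⁺? = λ x y → E? (suc x) (suc y)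
  P⁺? = λ x → P? (suc x)
  N?  = λ x → P? (suc x) ×-dec E? zero (suc x)
  distribute : ∀ a b c → 6 * (a + b * c) ≡ 6 * a + 3 * (b * (2 * c))
  distribute = ℕ-solve-∀

6*𝒦₃ : ∀ {n} {E : Rel (Fin n) 0ℓ} (E? : Decidable E) → Symmetric E → (∀ x → ¬ E x x) →
  6 * 𝒦 3 E? ≡ ∑[ x < n ] ∑[ y < n ] ∑[ z < n ] (𝟙 (E? x y) * (𝟙 (E? y z) * 𝟙 (E? x z)))
6*𝒦₃ {n} E? E-sym E-irrefl = begin
  6 * 𝒦 3 E?
    ≡⟨ cong (6 *_) (count-cong (λ s → (∣ s ∣ˢ ℕ.≟ 3) ×-dec isClique? E? s) (cliqueIn? E? (λ _ → yes tt) 3)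
         (λ (o , c) → cliqueIn o c (λ _ _ → tt)) (λ c → order c , clique c)) ⟩
  6 * #cliques E? (λ _ → yes tt) 3
    ≡⟨ 6*#cliques-3 E? (λ _ → yes tt) E-sym E-irrefl ⟩
  triangles n (λ _ → 𝟙 (yes tt)) (λ x y → 𝟙 (E? x y))
    ≡⟨ cong (λ k → triangles n (λ _ → k) (λ x y → 𝟙 (E? x y))) (𝟙-yes (yes tt) tt) ⟩
  triangles n (λ _ → 1) (λ x y → 𝟙 (E? x y))
    ≡⟨ sum-cong-≗ {n} (λ x → sum-cong-≗ {n} (λ y → sum-cong-≗ {n} (λ z → unweight (𝟙 (E? x y) * (𝟙 (E? y z) * 𝟙 (E? x z)))))) ⟩
  ∑[ x < n ] ∑[ y < n ] ∑[ z < n ] (𝟙 (E? x y) * (𝟙 (E? y z) * 𝟙 (E? x z)))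
    ∎
  where
  open ≡-Reasoning
  unweight : ∀ a → 1 * (1 * (1 * a)) ≡ a
  unweight = ℕ-solve-∀

-- The Paley-type graph

module _ (n : ℕ) .{{_ : NonZero n}} where

  edge⇒unitSquare : ∀ (x y : Fin n) → G n x y → UnitSquare n (⟦ x ⟧ -ᶻ ⟦ y ⟧)
  edge⇒unitSquare x y (a , (b , ab≡1) , x-y≡a²) = ⟦ a ⟧ , unit ⟦ b ⟧ (≈-by ab≡1) , ≈-by x-y≡a²

  unitSquare⇒edge : ∀ (x y : Fin n) → UnitSquare n (⟦ x ⟧ -ᶻ ⟦ y ⟧) → G n x y
  unitSquare⇒edge x y (a , unit b ab≈1 , x-y≈a²) = residue n a ,
    (residue n b , congruent (≈-trans (*-cong (residue-≈ n a) (residue-≈ n b)) ab≈1)) ,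
    congruent (≈-trans x-y≈a² (≈-sym (*-cong (residue-≈ n a) (residue-≈ n a))))

  -- If -1 ≡ i² and x - y ≡ a², then y - x ≡ (i a)².
  G-symmetric : UnitSquare n -1ℤ → Symmetric (G n)
  G-symmetric (i , unit-i , -1≈i²) {x} {y} Gxy =
    let a , unit-a , x-y≈a² = edge⇒unitSquare x y Gxy in
    unitSquare⇒edge y x (i *ᶻ a , unit-* unit-i unit-a ,
      ≈-trans (≈-reflexive (eq₁ ⟦ x ⟧ ⟦ y ⟧)) (≈-trans (*-cong -1≈i² x-y≈a²) (≈-reflexive (eq₂ i a))))
    where
    eq₁ : ∀ x y → y -ᶻ x ≡ -1ℤ *ᶻ (x -ᶻ y)
    eq₁ = solve-∀
    eq₂ : ∀ i a → i *ᶻ i *ᶻ (a *ᶻ a) ≡ i *ᶻ a *ᶻ (i *ᶻ a)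
    eq₂ = solve-∀

  -- A loop would make 0 the square of a unit, hence a unit itself, and 0 · b ≡ 1 forces 1 ≡ 0.
  G-irreflexive : ¬ 1ℤ ≈ 0ℤ [ n ] → ∀ x → ¬ G n x x
  G-irreflexive 1≉0 x Gxx =
    let a , unit-a , 0≈a² = edge⇒unitSquare x x Gxx
        unit b 0*b≈1 = unit-resp (≈-trans (≈-sym 0≈a²) (≈-reflexive (ℤ.+-inverseʳ ⟦ x ⟧))) (unit-* unit-a unit-a)
    in 1≉0 (≈-sym 0*b≈1)

  6*𝒦₃≡#triangles : UnitSquare n -1ℤ → ¬ 1ℤ ≈ 0ℤ [ n ] → 6 * 𝒦 3 (G? n) ≡ #triangles n
  6*𝒦₃≡#triangles -1-square 1≉0 = begin
    6 * 𝒦 3 (G? n)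
      ≡⟨ 6*𝒦₃ (G? n) (λ {x} {y} → G-symmetric -1-square {x} {y}) (G-irreflexive 1≉0) ⟩
    ∑[ x < n ] ∑[ y < n ] ∑[ z < n ] (𝟙 (G? n x y) * (𝟙 (G? n y z) * 𝟙 (G? n x z)))
      ≡⟨ sum-cong-≗ {n} (λ x → sum-cong-≗ {n} (λ y → sum-cong-≗ {n} (λ z → cong₂ _*_ (edge x y) (cong₂ _*_ (edge y z) (edge x z))))) ⟩
    ∑[ x < n ] ∑[ y < n ] ∑[ z < n ] f ⟦ x ⟧ ⟦ y ⟧ ⟦ z ⟧
      ≡⟨ sum-cong-≗ {n} (λ x → sum-cong-≗ {n} (λ y → sym (∑mod≡∑ {n} (f ⟦ x ⟧ ⟦ y ⟧)))) ⟩
    ∑[ x < n ] ∑[ y < n ] ∑mod n (f ⟦ x ⟧ ⟦ y ⟧)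
      ≡⟨ sum-cong-≗ {n} (λ x → sym (∑mod≡∑ {n} (λ y → ∑mod n (f ⟦ x ⟧ y)))) ⟩
    ∑[ x < n ] ∑mod n (λ y → ∑mod n (f ⟦ x ⟧ y))
      ≡⟨ ∑mod≡∑ {n} (λ x → ∑mod n (λ y → ∑mod n (f x y))) ⟨
    #triangles n
      ∎
    where
    open ≡-Reasoning
    f : ℤ → ℤ → ℤ → ℕ
    f x y z = σ n (x -ᶻ y) * (σ n (y -ᶻ z) * σ n (x -ᶻ z))
    edge : ∀ x y → 𝟙 (G? n x y) ≡ σ n (⟦ x ⟧ -ᶻ ⟦ y ⟧)
    edge x y = 𝟙-cong (G? n x y) (unitSquare? n (⟦ x ⟧ -ᶻ ⟦ y ⟧)) (edge⇒unitSquare x y) (unitSquare⇒edge x y)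

-- From prime powers to n, and from natural numbers to rationals

∏ℤ-pos : ∀ {k} (f : Fin k → ℕ) (g : Fin k → ℤ) → (∀ i → + f i ≡ g i) → + ∏ f ≡ ∏ℤ g
∏ℤ-pos {zero}  f g eq = refl
∏ℤ-pos {suc k} f g eq = trans (ℤ.pos-* (f zero) (∏ (f ∘ suc))) (cong₂ _*ᶻ_ (eq zero) (∏ℤ-pos (f ∘ suc) (g ∘ suc) (eq ∘ suc)))

∏≢0⇒ : ∀ {k} (f : Fin k → ℕ) → (∀ i → f i ≢ 0) → ∏ f ≢ 0
∏≢0⇒ f f≢0 = ℕ.≢-nonZero⁻¹ (∏ f) {{∏≢0 f (λ i → ℕ.≢-nonZero (f≢0 i))}}

module _ {k} (p a : Fin (suc k) → ℕ) (p-prime : ∀ i → Prime (p i)) (p-injective : Injective _≡_ _≡_ p)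
         (p%4≡1 : ∀ i → p i % 4 ≡ 1) where

  private
    module PP (i : Fin (suc k)) = PrimePower (p i) (a i) (p-prime i) (p%4≡1 i)

    N : Fin (suc k) → ℕ
    N i = p i ^ suc (a i)

    n : ℕ
    n = ∏ N

    instance
      n≢0 : NonZero n
      n≢0 = ∏≢0 N PP.N≢0

    N-coprime : ∀ {i j} → i ≢ j → Coprime (N i) (N j)
    N-coprime {i} {j} i≢j = coprime-^ (suc (a i)) (suc (a j))
      (distinct-primes-coprime (p-prime i) (p-prime j) (i≢j ∘ p-injective))

    #√1-n : #√1 n ≡ 2 ^ suc k
    #√1-n = trans (∑mod-∏ (√𝟙-multiplicative 1ℤ) N PP.N≢0 N-coprime)
      (trans (∏-cong PP.#√1-N) (∏-const (suc k) 2))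

    φ-n : φ n ≡ ∏ (λ i → p i ^ a i * φ (p i) {{PP.p≢0 i}})
    φ-n = trans (∑mod-∏ υ-multiplicative N PP.N≢0 N-coprime) (∏-cong PP.φ-N)

    ∑α-n : ∑mod n (α n) ≡ ∏ (λ i → p i ^ a i * ∑mod (p i) (α (p i) {{PP.p≢0 i}}))
    ∑α-n = trans (∑mod-∏ α-multiplicative N PP.N≢0 N-coprime) (∏-cong PP.∑α-N)

    -- The number of solutions of x² = -1 modulo `n` is the product of the corresponding numbers
    -- modulo the prime powers, none of which is zero. A solution i is a unit with inverse -i.
    -1-square : UnitSquare n -1ℤ
    -1-square = i , unit (-ᶻ i) (≈-lin -1ℤ i²≈-1 (eq i)) , ≈-sym i²≈-1
      where
      root : ∃ λ x → x *ᶻ x ≈ -1ℤ [ n ]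
      root = ∑mod-≢0 n (λ x → x *ᶻ x ≈? -1ℤ [ n ])
        (subst (_≢ 0) (sym (∑mod-∏ (√𝟙-multiplicative -1ℤ) N PP.N≢0 N-coprime)) (∏≢0⇒ _ PP.#√-1-N≢0))
      i = proj₁ root
      i²≈-1 = proj₂ root
      eq : ∀ i → i *ᶻ -ᶻ i -ᶻ 1ℤ ≡ -1ℤ *ᶻ (i *ᶻ i -ᶻ -1ℤ)
      eq = solve-∀

    -- This rests on there being at least one prime factor: the congruence would descend to the
    -- prime at index `zero`.
    1≉0 : ¬ 1ℤ ≈ 0ℤ [ n ]
    1≉0 p≈0 = PP.unit⇒≉0 zero unit-1 (≈-factorˡ (p zero ^ a zero) (p zero) (≈-factorˡ (∏ (N ∘ suc)) (N zero) p≈0))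

    factor : Fin (suc k) → ℕ
    factor i = N i * (p i ^ a i * φ (p i) {{PP.p≢0 i}} * (p i ^ a i * ∑mod (p i) (α (p i) {{PP.p≢0 i}})))

    count-ℕ : 3 * 2 ^ (3 * suc k + 1) * 𝒦 3 (G? n) ≡ ∏ factor
    count-ℕ = begin
      3 * 2 ^ (3 * suc k + 1) * K                        ≡⟨ cong (λ m → 3 * m * K) (ℕ.^-distribˡ-+-* 2 (3 * suc k) 1) ⟩
      -- The constant regroups as 6, for the orderings of a triangle, times the cube of `#√1 n`, one
      -- factor 2 ^ suc k for each edge.
      3 * (2 ^ (3 * suc k) * 2) * K                      ≡⟨ regroup (2 ^ (3 * suc k)) K ⟩
      2 ^ (3 * suc k) * (6 * K)                          ≡⟨ cong (λ m → 2 ^ m * (6 * K)) (ℕ.*-comm 3 (suc k)) ⟩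
      2 ^ (suc k * 3) * (6 * K)                          ≡⟨ cong (_* (6 * K)) (ℕ.^-*-assoc 2 (suc k) 3) ⟨
      (2 ^ suc k) ^ 3 * (6 * K)                          ≡⟨ cong₂ (λ r t → r ^ 3 * t) (sym #√1-n) (6*𝒦₃≡#triangles n -1-square 1≉0) ⟩
      #√1 n ^ 3 * #triangles n                           ≡⟨ #√1³*#triangles n (∏-unit N (λ i → PP.unit-^ i (PP.unit-2 i) (suc (a i)))) ⟩
      n * (φ n * ∑mod n (α n))                           ≡⟨ cong (n *_) (cong₂ _*_ φ-n ∑α-n) ⟩
      n * (∏ Φ * ∏ A)                                    ≡⟨ cong (n *_) (∏-* Φ A) ⟨
      n * ∏ (λ i → Φ i * A i)                            ≡⟨ ∏-* N (λ i → Φ i * A i) ⟨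
      ∏ factor                                           ∎
      where
      open ≡-Reasoning
      K = 𝒦 3 (G? n)
      Φ A : Fin (suc k) → ℕ
      Φ i = p i ^ a i * φ (p i) {{PP.p≢0 i}}
      A i = p i ^ a i * ∑mod (p i) (α (p i) {{PP.p≢0 i}})
      regroup : ∀ x y → 3 * (x * 2) * y ≡ x * (6 * y)
      regroup = ℕ-solve-∀

    pos-∸ : ∀ {m} c {l} → m + c ≡ l → + m ≡ + l -ᶻ + c
    pos-∸ {m} c {l} eq = trans (cancel (+ m) (+ c)) (cong (_-ᶻ + c) (trans (sym (ℤ.pos-+ m c)) (cong +_ eq)))
      where
      cancel : ∀ x y → x ≡ x +ᶻ y -ᶻ y
      cancel = solve-∀

    -- The vertex, the unit count and the count of `α` contribute p^(a+1), p^a and p^a, together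
    -- p^(3a+1). With exponent a + 1 this is p^(3(a+1) - 2), and the truncated subtraction is exact.
    factor-ℤ : ∀ i → + factor i ≡ + (p i ^ (3 * suc (a i) ∸ 2)) *ᶻ (+ p i -ᶻ + 1) *ᶻ (+ p i -ᶻ + 5)
    factor-ℤ i = begin
      + factor i                                  ≡⟨ cong +_ (regroup (p i) (p i ^ a i) x y) ⟩
      + (p i * (p i ^ a i) ^ 3 * x * y)           ≡⟨ cong (λ m → + (p i * m * x * y)) (trans (ℕ.^-*-assoc (p i) (a i) 3) (cong (p i ^_) (ℕ.*-comm (a i) 3))) ⟩
      + (p i ^ (1 + 3 * a i) * x * y)             ≡⟨ cong (λ e → + (p i ^ e * x * y)) (exponent (a i)) ⟨
      + (p i ^ (3 * suc (a i) ∸ 2) * x * y)       ≡⟨ trans (ℤ.pos-* (p i ^ (3 * suc (a i) ∸ 2) * x) y) (cong (_*ᶻ + y) (ℤ.pos-* (p i ^ (3 * suc (a i) ∸ 2)) x)) ⟩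
      + (p i ^ (3 * suc (a i) ∸ 2)) *ᶻ + x *ᶻ + y
        ≡⟨ cong₂ (λ u v → + (p i ^ (3 * suc (a i) ∸ 2)) *ᶻ u *ᶻ v) (pos-∸ 1 (PP.φ+1≡p i)) (pos-∸ 5 (PP.∑α+5≡p i)) ⟩
      + (p i ^ (3 * suc (a i) ∸ 2)) *ᶻ (+ p i -ᶻ + 1) *ᶻ (+ p i -ᶻ + 5)     ∎
      where
      open ≡-Reasoning
      x = φ (p i) {{PP.p≢0 i}}
      y = ∑mod (p i) (α (p i) {{PP.p≢0 i}})
      regroup : ∀ q r x y → q * r * (r * x * (r * y)) ≡ q * (r * (r * (r * 1))) * x * y
      regroup = ℕ-solve-∀
      exponent : ∀ b → 3 * suc b ∸ 2 ≡ 1 + 3 * b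
      exponent b = trans (cong (_∸ 2) (expand b)) (ℕ.m+n∸m≡n 2 (1 + 3 * b))
        where
        expand : ∀ b → 3 * suc b ≡ 2 + (1 + 3 * b)
        expand b = trans (ℕ.*-suc 3 b) refl

  clique-count : + (3 * 2 ^ (3 * suc k + 1)) *ᶻ + 𝒦 3 (G? (∏ (λ i → p i ^ suc (a i)))) ≡
    ∏ℤ (λ i → + (p i ^ (3 * suc (a i) ∸ 2)) *ᶻ (+ p i -ᶻ + 1) *ᶻ (+ p i -ᶻ + 5))
  clique-count = trans (sym (ℤ.pos-* (3 * 2 ^ (3 * suc k + 1)) (𝒦 3 (G? n)))) (trans (cong +_ count-ℕ) (∏ℤ-pos factor _ factor-ℤ))

∏ℤ-cong : ∀ {k} {f g : Fin k → ℤ} → (∀ i → f i ≡ g i) → ∏ℤ f ≡ ∏ℤ g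
∏ℤ-cong {zero}  eq = refl
∏ℤ-cong {suc k} eq = cong₂ _*ᶻ_ (eq zero) (∏ℤ-cong (eq ∘ suc))

-- Passing to unnormalised rationals avoids the reduction to lowest terms; equality there is
-- cross-multiplication, which is the given integer equation.
1/d*-solves : ∀ d .{{_ : NonZero d}} {x y} → + d *ᶻ x ≡ y → x / 1 ≡ (+ 1 / d) ℚ.* (y / 1)
1/d*-solves (suc d) {x} {y} eq = ℚ.toℚᵘ-injective (begin
  ℚ.toℚᵘ (x / 1)                                 ≈⟨ ℚ.toℚᵘ-fromℚᵘ (mkℚᵘ x 0) ⟩
  mkℚᵘ x 0                                       ≈⟨ *≡* (cross x y (+ suc d) eq) ⟩
  mkℚᵘ (+ 1) d ℚᵘ.* mkℚᵘ y 0                     ≈⟨ ℚᵘ.*-cong (ℚ.toℚᵘ-fromℚᵘ (mkℚᵘ (+ 1) d)) (ℚ.toℚᵘ-fromℚᵘ (mkℚᵘ y 0)) ⟨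
  ℚ.toℚᵘ (+ 1 / suc d) ℚᵘ.* ℚ.toℚᵘ (y / 1)       ≈⟨ ℚ.toℚᵘ-homo-* (+ 1 / suc d) (y / 1) ⟨
  ℚ.toℚᵘ ((+ 1 / suc d) ℚ.* (y / 1))             ∎)
  where
  open ℚᵘ.≃-Reasoning
  cross : ∀ x y d → d *ᶻ x ≡ y → x *ᶻ (d *ᶻ + 1) ≡ + 1 *ᶻ y *ᶻ + 1
  cross x y d refl = eq′ x d
    where
    eq′ : ∀ x d → x *ᶻ (d *ᶻ + 1) ≡ + 1 *ᶻ (d *ᶻ x) *ᶻ + 1
    eq′ = solve-∀

theorem1p1 : ∀ (k : ℕ) (p α : Fin k → ℕ) (n : ℕ) →
    1 ≤ k →
    (∀ i → 1 ≤ α i) →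
    (∀ i → Prime (p i)) →
    Injective _≡_ _≡_ p →
    (∀ i → p i % 4 ≡ 1) →
    n ≡ ∏ (λ i → p i ^ α i) →
    + 𝒦 3 (G? n) / 1
    ≡ _/_ (+ 1) (3 * 2 ^ (3 * k + 1)) {{3*2^m≢0 (3 * k + 1)}}
    ℚ.* (∏ℤ (λ i → + (p i ^ (3 * α i ∸ 2)) ℤ.* (+ p i ℤ.- + 1) ℤ.* (+ p i ℤ.- + 5)) / 1)
theorem1p1 (suc k) p α n 1≤k 1≤α p-prime p-injective p%4≡1 n≡∏ =
  1/d*-solves (3 * 2 ^ (3 * suc k + 1)) {{3*2^m≢0 (3 * suc k + 1)}} (begin
    + (3 * 2 ^ (3 * suc k + 1)) *ᶻ + 𝒦 3 (G? n)
      ≡⟨ cong (λ m → + (3 * 2 ^ (3 * suc k + 1)) *ᶻ + 𝒦 3 (G? m)) (trans n≡∏ (∏-cong (λ i → cong (p i ^_) (α≡suc i)))) ⟩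
    + (3 * 2 ^ (3 * suc k + 1)) *ᶻ + 𝒦 3 (G? (∏ (λ i → p i ^ suc (a i))))
      ≡⟨ clique-count p a p-prime p-injective p%4≡1 ⟩
    ∏ℤ (λ i → + (p i ^ (3 * suc (a i) ∸ 2)) *ᶻ (+ p i -ᶻ + 1) *ᶻ (+ p i -ᶻ + 5))
      ≡⟨ ∏ℤ-cong (λ i → cong (λ e → + (p i ^ (3 * e ∸ 2)) *ᶻ (+ p i -ᶻ + 1) *ᶻ (+ p i -ᶻ + 5)) (α≡suc i)) ⟨
    ∏ℤ (λ i → + (p i ^ (3 * α i ∸ 2)) *ᶻ (+ p i -ᶻ + 1) *ᶻ (+ p i -ᶻ + 5))
      ∎)
  where
  open ≡-Reasoning
  a : Fin (suc k) → ℕ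
  -- Every exponent is at least 1, hence the successor of its predecessor, which is the form used
  -- for prime powers.
  a i = ℕ.pred (α i)
  α≡suc : ∀ i → α i ≡ suc (a i)
  α≡suc i = sym (ℕ.suc-pred (α i) {{ℕ.>-nonZero (1≤α i)}})
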